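{- Let $n\ge 2$ and $0\le k\le \lfloor n/3\rfloor$ be integers, and let $R$ be a random subset of the cyclic group $C_n$ obtained by choosing each element of $C_n$ independently with probability $p$. Let $N^R_{n-1-k}$ be the number of zero-sum free sequences of length $n-1-k$ contained in $R$. Then $$\mathbb E\left(N^R_{n-1-k}\right)=\varphi(n)\left[p+\sum_{d=2}^{D}p^d\left(\sum_{j=\frac{(d-1)d}{2}}^{k}q(j,d-1)\right)\right],$$ where $D=\left\lfloor\frac{1+\sqrt{1+8k}}{2}\right\rfloor$, $\varphi(n)$ denotes the number of generators of $C_n$, and $q(j,d-1)$ is the number of partitions of $j$ having exactly $d-1$ distinct parts.
   Context: $C_n$ is the cyclic group of order $n$, written additively. A sequence of length $\ell$ over $C_n$ is an unordered collection with repetition allowed (a multiset) $S=a_1\cdot a_2\cdot\ldots\cdot a_\ell$ of $\ell$ elements of $C_n$. A subsequence of $S$ is a sequence $T$ in which the multiplicity of each $a\in C_n$ is at most its multiplicity in $S$. $S$ is a zero-sum sequence if $a_1+\dots+a_\ell=0$, and $S$ is zero-sum free if it contains no (nonempty) zero-sum subsequence. $S$ is contained in $A\subset C_n$ if every element occurring in $S$ lies in $A$. A partition of a positive integer $j$ is a non-decreasing sequence of positive integers with sum $j$. For $j,d\ge1$, $q(j,d)$ is the number of partitions of $j$ in which exactly $d$ different part sizes occur (parts may be repeated); e.g. $q(7,1)=2$, $q(7,2)=11$, $q(7,3)=2$. Empty sums are $0$.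
   Formalization: The pairs (n,k)=(3,1) and (6,2) are excluded because the formula fails there: for (3,1) the expectation is 2p but the formula gives 2p+2p²; for (6,2) the zero-sum free sequence 1·3·4 contributes a p³ term that the formula lacks. -}

module Defs where

open import Algebra.Bundles using (CommutativeRing; Semiring)
open import Algebra.Bundles.Raw using (RawMonoid)
import Algebra.Definitions.RawMonoid as RawMonoidDefs
import Algebra.Definitions.RawSemiring as RawSemiringDefs
open import Data.Bool.Base using (Bool; true; false; if_then_else_)
open import Data.Fin.Base using (Fin; toℕ; fromℕ<)
import Data.Fin.Base as Fin
import Data.Fin.Properties as Fin
open import Data.Fin.Subset using (Subset)
import Data.Fin.Subset as Subset
open import Data.Fin.Subset.Properties using () renaming (_∈?_ to _∈ˢ?_)
open import Data.List.Base
  using (List; []; _∷_; length; map; filter; deduplicate; upTo; allFin; foldr; cartesianProductWith)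
import Data.Nat.ListAction as ListAction
open import Data.List.Membership.Propositional using (_∈_)
open import Data.List.Membership.Propositional.Properties
  using (∈-filter⁺; ∈-filter⁻; ∈-upTo⁺; ∈-upTo⁻; ∈-allFin;
         ∈-cartesianProductWith⁺; ∈-cartesianProductWith⁻)
open import Data.List.Properties using (∷-injective)
open import Data.List.Relation.Unary.All using (All; []; _∷_)
import Data.List.Relation.Unary.All as All
open import Data.List.Relation.Unary.AllPairs using ([]; _∷_)
open import Data.List.Relation.Unary.Any using (Any; here; there; any?; satisfied)
open import Data.List.Relation.Unary.Linked using (Linked; linked?)
open import Data.List.Relation.Unary.Unique.Propositional using (Unique)
import Data.List.Relation.Unary.Unique.Propositional.Properties as Unique
open import Data.Nat.Base hiding (_⊔_)
open import Data.Nat.DivMod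
open import Data.Nat.Properties
open import Data.Product.Base using (∃; _×_; _,_; proj₂)
open import Data.Unit.Base using (⊤; tt)
open import Data.Vec.Base using (Vec; []; _∷_; lookup)
import Data.Vec.Base as Vec
import Data.Vec.Properties as Vec
open import Data.Vec.Relation.Unary.All using ([]; _∷_) renaming (All to Allᵛ)
import Data.Vec.Relation.Unary.All as Allᵛ
open import Function.Base using (_∘_; _$_)
open import Function.Bundles using (_⇔_; mk⇔; module Equivalence)
open import Level using (0ℓ; _⊔_) renaming (suc to lsuc)
open import Relation.Binary.Core using (Rel)
open import Relation.Binary.Structures using (IsPartialOrder)
open import Relation.Binary.PropositionalEquality using (_≡_; refl; trans; cong; module ≡-Reasoning)
open import Relation.Nullary using (¬_; Dec; yes; no; does; ¬?; _×-dec_; _→-dec_)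
import Relation.Nullary.Decidable as Dec
open import Relation.Unary using (Pred; Decidable)

-- Cardinality of a finite set {x | P x}: the length of a
-- duplicate-free list of exactly its elements.
record Enumeration {A : Set} (P : Pred A 0ℓ) : Set where
  field
    elements : List A
    unique   : Unique elements
    member⇔  : ∀ {x} → x ∈ elements ⇔ P x

open Enumeration public

card : {A : Set} {P : Pred A 0ℓ} → Enumeration P → ℕ
card = length ∘ elements

refine : {A : Set} {P Q : Pred A 0ℓ} → Enumeration P → Decidable Q →
         (∀ {x} → Q x → P x) → Enumeration Q
refine e Q? Q⊆P = record
  { elements = filter Q? (elements e)
  ; unique   = Unique.filter⁺ Q? (unique e)
  ; member⇔  = mk⇔
      (λ x∈ → proj₂ (∈-filter⁻ Q? {xs = elements e} x∈))
      (λ q → ∈-filter⁺ Q? (Equivalence.from (member⇔ e) (Q⊆P q)) q)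
  }

∃? : {A : Set} {P Q : Pred A 0ℓ} → Enumeration P → Decidable Q →
     (∀ {x} → Q x → P x) → Dec (∃ Q)
∃? {A} {P} {Q} e Q? Q⊆P = Dec.map′ satisfied found (any? Q? (elements e))
  where
  locate : ∀ {x xs} → Q x → x ∈ xs → Any Q xs
  locate q (here refl) = here q
  locate q (there x∈)  = there (locate q x∈)

  found : ∃ Q → Any Q (elements e)
  found (x , q) = locate q (Equivalence.from (member⇔ e) (Q⊆P q))

fins : ∀ n → Enumeration {Fin n} (λ _ → ⊤)
fins n = record
  { elements = allFin n
  ; unique   = Unique.allFin⁺ n
  ; member⇔  = mk⇔ (λ _ → tt) (λ _ → ∈-allFin _)
  }

below : ∀ m → Enumeration (_≤ m)
below m = record
  { elements = upTo (suc m)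
  ; unique   = Unique.upTo⁺ (suc m)
  ; member⇔  = mk⇔ (λ i∈ → ≤-pred (∈-upTo⁻ i∈)) (λ i≤m → ∈-upTo⁺ (s≤s i≤m))
  }

bools : Enumeration {Bool} (λ _ → ⊤)
bools = record
  { elements = true ∷ false ∷ []
  ; unique   = ((λ ()) ∷ []) ∷ [] ∷ []
  ; member⇔  = mk⇔ (λ _ → tt) (λ _ → complete _)
  }
  where
  complete : ∀ b → b ∈ true ∷ false ∷ []
  complete true  = here refl
  complete false = there (here refl)

vecs : {A : Set} {P : Pred A 0ℓ} → Enumeration P → ∀ n → Enumeration {Vec A n} (Allᵛ P)
vecs e zero = record
  { elements = [] ∷ []
  ; unique   = [] ∷ []
  ; member⇔  = mk⇔ (λ { (here refl) → [] }) (λ { [] → here refl })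
  }
vecs {A} {P} e (suc n) = record
  { elements = cartesianProductWith _∷_ xs xss
  ; unique   = Unique.cartesianProductWith⁺ _∷_ Vec.∷-injective (unique e) (unique (vecs e n))
  ; member⇔  = mk⇔ sound complete
  }
  where
  xs  = elements e
  xss = elements (vecs e n)

  sound : ∀ {v} → v ∈ cartesianProductWith _∷_ xs xss → Allᵛ P v
  sound v∈ with _ , _ , a∈ , b∈ , refl ← ∈-cartesianProductWith⁻ _∷_ xs xss v∈ =
    Equivalence.to (member⇔ e) a∈ ∷ Equivalence.to (member⇔ (vecs e n)) b∈

  complete : ∀ {v} → Allᵛ P v → v ∈ cartesianProductWith _∷_ xs xss
  complete (p ∷ ps) = ∈-cartesianProductWith⁺ _∷_
    (Equivalence.from (member⇔ e) p) (Equivalence.from (member⇔ (vecs e n)) ps)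

lists : {A : Set} {P : Pred A 0ℓ} → Enumeration P → ∀ n →
        Enumeration (λ xs → length xs ≤ n × All P xs)
lists e zero = record
  { elements = [] ∷ []
  ; unique   = [] ∷ []
  ; member⇔  = mk⇔ (λ { (here refl) → z≤n , [] }) (λ { (_ , []) → here refl })
  }
lists {A} {P} e (suc n) = record
  { elements = [] ∷ cartesianProductWith _∷_ xs xss
  ; unique   = All.tabulate nonempty
             ∷ Unique.cartesianProductWith⁺ _∷_ ∷-injective (unique e) (unique (lists e n))
  ; member⇔  = mk⇔ sound complete
  }
  where
  xs  = elements e
  xss = elements (lists e n)

  nonempty : ∀ {ys} → ys ∈ cartesianProductWith _∷_ xs xss → ¬ ([] ≡ ys)
  nonempty ys∈ refl with _ , _ , _ , _ , () ← ∈-cartesianProductWith⁻ _∷_ xs xss ys∈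

  sound : ∀ {ys} → ys ∈ [] ∷ cartesianProductWith _∷_ xs xss → length ys ≤ suc n × All P ys
  sound (here refl) = z≤n , []
  sound (there ys∈) with _ , _ , a∈ , b∈ , refl ← ∈-cartesianProductWith⁻ _∷_ xs xss ys∈ =
    let l≤n , ps = Equivalence.to (member⇔ (lists e n)) b∈
    in s≤s l≤n , Equivalence.to (member⇔ e) a∈ ∷ ps

  complete : ∀ {ys} → length ys ≤ suc n × All P ys → ys ∈ [] ∷ cartesianProductWith _∷_ xs xss
  complete (_ , [])           = here refl
  complete (s≤s l≤n , p ∷ ps) = there $ ∈-cartesianProductWith⁺ _∷_
    (Equivalence.from (member⇔ e) p) (Equivalence.from (member⇔ (lists e n)) (l≤n , ps))

C : (n : ℕ) → .{{NonZero n}} → RawMonoid 0ℓ 0ℓ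
C n = record
  { Carrier = Fin n
  ; _≈_     = _≡_
  ; _∙_     = λ a b → (toℕ a + toℕ b) mod n
  ; ε       = 0 mod n
  }

module _ (n : ℕ) .{{_ : NonZero n}} where

  open RawMonoidDefs (C n) using () renaming (_×_ to _·_)

  IsGenerator : Pred (Fin n) 0ℓ
  IsGenerator g = ∀ x → ∃ λ m → m · g ≡ x

  toℕ-· : ∀ m g → toℕ (m · g) ≡ (m * toℕ g) % n
  toℕ-· zero    g = Fin.toℕ-fromℕ< _
  toℕ-· (suc m) g = begin
    toℕ ((toℕ g + toℕ (m · g)) mod n)       ≡⟨ Fin.toℕ-fromℕ< _ ⟩
    (toℕ g + toℕ (m · g)) % n               ≡⟨ cong (λ s → (toℕ g + s) % n) (toℕ-· m g) ⟩
    (toℕ g + (m * toℕ g) % n) % n           ≡⟨ %-distribˡ-+ (toℕ g) _ n ⟩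
    (toℕ g % n + (m * toℕ g) % n % n) % n   ≡⟨ cong (λ s → (toℕ g % n + s) % n) (m%n%n≡m%n (m * toℕ g) n) ⟩
    (toℕ g % n + (m * toℕ g) % n) % n       ≡⟨ %-distribˡ-+ (toℕ g) _ n ⟨
    (toℕ g + m * toℕ g) % n                 ∎
    where open ≡-Reasoning

  ·-mod : ∀ m g → toℕ (m mod n) · g ≡ m · g
  ·-mod m g = Fin.toℕ-injective $ begin
    toℕ (toℕ (m mod n) · g)                 ≡⟨ toℕ-· (toℕ (m mod n)) g ⟩
    (toℕ (m mod n) * toℕ g) % n             ≡⟨ cong (λ s → (s * toℕ g) % n) (Fin.toℕ-fromℕ< (m%n<n m n)) ⟩
    (m % n * toℕ g) % n                     ≡⟨ %-distribˡ-* (m % n) (toℕ g) n ⟩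
    ((m % n % n) * (toℕ g % n)) % n         ≡⟨ cong (λ s → (s * (toℕ g % n)) % n) (m%n%n≡m%n m n) ⟩
    ((m % n) * (toℕ g % n)) % n             ≡⟨ %-distribˡ-* m (toℕ g) n ⟨
    (m * toℕ g) % n                         ≡⟨ toℕ-· m g ⟨
    toℕ (m · g)                             ∎
    where open ≡-Reasoning

  isGenerator? : Decidable IsGenerator
  isGenerator? g = Fin.all? λ x → Dec.map′
    (λ (i , eq) → toℕ i , eq)
    (λ (m , eq) → m mod n , trans (·-mod m g) eq)
    (Fin.any? λ i → (toℕ i · g) Fin.≟ x)

  generators : Enumeration IsGenerator
  generators = refine (fins n) isGenerator? (λ _ → tt)

  φ : ℕ
  φ = card generators

-- A multiset over Cₙ, given by its vector of multiplicities.
Sequence : ℕ → Set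
Sequence n = Vec ℕ n

mult : ∀ {n} → Fin n → Sequence n → ℕ
mult a S = lookup S a

∣_∣ˢ : ∀ {n} → Sequence n → ℕ
∣_∣ˢ = Vec.sum

infix 4 _⊑_
_⊑_ : ∀ {n} → Rel (Sequence n) 0ℓ
T ⊑ S = ∀ a → mult a T ≤ mult a S

ContainedIn : ∀ {n} → Subset n → Pred (Sequence n) 0ℓ
ContainedIn A S = ∀ a → 0 < mult a S → a Subset.∈ A

lookup≤sum : ∀ {n} (S : Sequence n) a → lookup S a ≤ Vec.sum S
lookup≤sum (x ∷ S) Fin.zero    = m≤m+n x _
lookup≤sum (x ∷ S) (Fin.suc a) = ≤-trans (lookup≤sum S a) (m≤n+m _ x)

lookup⇒All : ∀ {n} {P : Pred ℕ 0ℓ} (S : Sequence n) → (∀ a → P (lookup S a)) → Allᵛ P S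
lookup⇒All []      h = []
lookup⇒All (x ∷ S) h = h Fin.zero ∷ lookup⇒All S (h ∘ Fin.suc)

module _ (n : ℕ) .{{_ : NonZero n}} where

  open RawMonoid (C n) using () renaming (ε to 0ᶜ)
  open RawMonoidDefs (C n) using () renaming (_×_ to _·_; sum to sumᶜ)

  σ : Sequence n → Fin n
  σ S = sumᶜ λ a → mult a S · a

  ZeroSum : Pred (Sequence n) 0ℓ
  ZeroSum S = σ S ≡ 0ᶜ

  ZeroSumFree : Pred (Sequence n) 0ℓ
  ZeroSumFree S = ¬ ∃ λ T → T ⊑ S × 0 < ∣ T ∣ˢ × ZeroSum T

  ZeroSumFreeIn : Subset n → ℕ → Pred (Sequence n) 0ℓ
  ZeroSumFreeIn A ℓ S = ∣ S ∣ˢ ≡ ℓ × ZeroSumFree S × ContainedIn A S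

  zeroSumFree? : Decidable ZeroSumFree
  zeroSumFree? S = ¬? $ ∃? (vecs (below ∣ S ∣ˢ) n)
    (λ T → Fin.all? (λ a → mult a T ≤? mult a S) ×-dec (0 <? ∣ T ∣ˢ) ×-dec (σ T Fin.≟ 0ᶜ))
    (λ {T} (T⊑S , _) → lookup⇒All T λ a → ≤-trans (T⊑S a) (lookup≤sum S a))

  zeroSumFreeSequences : ∀ A ℓ → Enumeration (ZeroSumFreeIn A ℓ)
  zeroSumFreeSequences A ℓ = refine (vecs (below ℓ) n)
    (λ S → (∣ S ∣ˢ ≟ ℓ) ×-dec zeroSumFree? S
           ×-dec Fin.all? (λ a → (0 <? mult a S) →-dec (a ∈ˢ? A)))
    (λ {S} (∣S∣≡ℓ , _) → lookup⇒All S λ a → ≤-trans (lookup≤sum S a) (≤-reflexive ∣S∣≡ℓ))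

  N : Subset n → ℕ → ℕ
  N A ℓ = card (zeroSumFreeSequences A ℓ)

IsPartition : ℕ → Pred (List ℕ) 0ℓ
IsPartition j xs = All (0 <_) xs × Linked _≤_ xs × ListAction.sum xs ≡ j

distinctParts : List ℕ → ℕ
distinctParts xs = length (deduplicate _≟_ xs)

length≤sum : ∀ {xs} → All (0 <_) xs → length xs ≤ ListAction.sum xs
length≤sum []         = z≤n
length≤sum (0<x ∷ ps) = +-mono-≤ 0<x (length≤sum ps)

parts≤sum : ∀ xs → All (_≤ ListAction.sum xs) xs
parts≤sum []       = []
parts≤sum (x ∷ xs) = m≤m+n x _ ∷ All.map (λ y≤ → ≤-trans y≤ (m≤n+m _ x)) (parts≤sum xs)

partitions : ∀ j d → Enumeration (λ xs → IsPartition j xs × distinctParts xs ≡ d)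
partitions j d = refine (lists (below j) j)
  (λ xs → (All.all? (0 <?_) xs ×-dec linked? _≤?_ xs ×-dec (ListAction.sum xs ≟ j))
          ×-dec (distinctParts xs ≟ d))
  (λ { {xs} ((pos , _ , refl) , _) → length≤sum pos , parts≤sum xs })

q : ℕ → ℕ → ℕ
q j d = card (partitions j d)

√-step : ℕ → ℕ → ℕ
√-step m s with suc s * suc s ≤? suc m
... | yes _ = suc s
... | no  _ = s

⌊√_⌋ : ℕ → ℕ
⌊√ zero ⌋  = 0
⌊√ suc m ⌋ = √-step m ⌊√ m ⌋

⌊√⌋-lower : ∀ m → ⌊√ m ⌋ * ⌊√ m ⌋ ≤ m
⌊√⌋-lower zero    = z≤n
⌊√⌋-lower (suc m) = step ⌊√ m ⌋ (⌊√⌋-lower m)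
  where
  step : ∀ s → s * s ≤ m → √-step m s * √-step m s ≤ suc m
  step s s²≤m with suc s * suc s ≤? suc m
  ... | yes le = le
  ... | no  _  = m≤n⇒m≤1+n s²≤m

⌊√⌋-upper : ∀ m → m < suc ⌊√ m ⌋ * suc ⌊√ m ⌋
⌊√⌋-upper zero    = s≤s z≤n
⌊√⌋-upper (suc m) = step ⌊√ m ⌋ (⌊√⌋-upper m)
  where
  step : ∀ s → m < suc s * suc s → suc m < suc (√-step m s) * suc (√-step m s)
  step s m<s² with suc s * suc s ≤? suc m
  ... | yes _  = ≤-<-trans m<s² (*-mono-< (n<1+n (suc s)) (n<1+n (suc s)))
  ... | no ¬le = ≰⇒> ¬le

-- ⌊(1 + √(1 + 8k)) / 2⌋; the inner floor does not change the value,
-- since ⌊x / 2⌋ = ⌊⌊x⌋ / 2⌋ for real x.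
D : ℕ → ℕ
D k = (1 + ⌊√ 1 + 8 * k ⌋) / 2

range : ℕ → ℕ → List ℕ
range a b = map (a +_) (upTo (suc b ∸ a))

∑ : ℕ → ℕ → (ℕ → ℕ) → ℕ
∑ a b f = ListAction.sum (map f (range a b))

-- Probabilities take values in an arbitrary ordered commutative ring,
-- of which ℝ is an instance. The order need not be total, so that
-- constructive reals are covered too.
record OrderedCommutativeRing c ℓ₁ ℓ₂ : Set (lsuc (c ⊔ ℓ₁ ⊔ ℓ₂)) where
  field
    commutativeRing : CommutativeRing c ℓ₁
  open CommutativeRing commutativeRing public
    renaming (_+_ to _+ᴿ_; _*_ to _*ᴿ_; _-_ to _-ᴿ_)
  infix 4 _≤ᴿ_
  field
    _≤ᴿ_           : Rel Carrier ℓ₂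
    isPartialOrder : IsPartialOrder _≈_ _≤ᴿ_
    0≤1            : 0# ≤ᴿ 1#
    +ᴿ-monoˡ       : ∀ {x y} z → x ≤ᴿ y → x +ᴿ z ≤ᴿ y +ᴿ z
    *ᴿ-nonneg      : ∀ {x y} → 0# ≤ᴿ x → 0# ≤ᴿ y → 0# ≤ᴿ x *ᴿ y

allSubsets : ∀ n → Enumeration {Subset n} (λ _ → ⊤)
allSubsets n = record
  { elements = elements e
  ; unique   = unique e
  ; member⇔  = mk⇔ (λ _ → tt) (λ _ → Equivalence.from (member⇔ e) (Allᵛ.universal (λ _ → tt) _))
  }
  where e = vecs bools n

module RandomSubset {c ℓ₁ ℓ₂} (R : OrderedCommutativeRing c ℓ₁ ℓ₂) where

  open OrderedCommutativeRing R
  open RawSemiringDefs (Semiring.rawSemiring semiring) using (sum; product) renaming (_×_ to _×ᴿ_; _^_ to _^ᴿ_) public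

  ⟨_⟩ : ℕ → Carrier
  ⟨ m ⟩ = m ×ᴿ 1#

  ∑ᴿ : ℕ → ℕ → (ℕ → Carrier) → Carrier
  ∑ᴿ a b f = foldr (λ i s → f i +ᴿ s) 0# (range a b)

  -- The probability that the random subset equals A, when each element
  -- is chosen independently with probability p.
  ℙ : Carrier → ∀ {n} → Subset n → Carrier
  ℙ p {n} A = product {n} λ x → if does (x ∈ˢ? A) then p else 1# -ᴿ p

  𝔼 : Carrier → ∀ {n} → (Subset n → Carrier) → Carrier
  𝔼 p {n} X = foldr (λ A s → ℙ p A *ᴿ X A +ᴿ s) 0# (elements (allSubsets n))

-- By linearity, the expectation is the sum of p ^ |supp S| over the zero-sum
-- free sequences S of length ℓ = n - 1 - k.  When 2ℓ > n, such an S has the form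
-- (j₁ g) … (j_ℓ g) for a generator g and positive integers of sum less than n
-- (Savchev and Chen); the only other admissible cases are (n , k) = (2 , 0) and
-- (4 , 1).  The nonzero jᵢ - 1 form a partition of some j ≤ k, and g has
-- multiplicity at least ℓ - k ≥ 1 in S, so |supp S| exceeds the number of
-- distinct parts by one.  If g and g′ = m g both worked, counting copies of g′
-- gives (ℓ - k) (m - 1) ≤ k, which forces m = 2 and, symmetrically, g = 2 g′,
-- so that 3 g = 0.
--
-- For the structure theorem, enlarge a subsequence having at least twice as many
-- subsums (0 included) as terms.  As there are at most n < 2ℓ subsums, this gets
-- stuck, and then every remaining term is one and the same element a, which S
-- determines.  Hence no such subsequence contains all h copies of a.  A term t
-- outside {a, 2 a, …, h a} would give one, namely the copies of a together with t.
module Submission where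

open import Algebra.Bundles using (CommutativeMonoid)
open import Algebra.Bundles.Raw using (RawMonoid)
import Algebra.Definitions.RawMonoid as RawMonoidDefs
import Algebra.Properties.CommutativeSemigroup as CommutativeSemigroupProperties
import Algebra.Properties.Monoid.Mult as Mult
open import Algebra.Structures using (IsCommutativeMonoid)
open import Data.Bool.Base using (true; false; if_then_else_)
open import Data.Fin.Base using (Fin; toℕ; zero; suc)
open import Data.Fin.Patterns using (0F; 1F; 2F; 3F)
import Data.Fin.Properties as Fin
open import Data.Fin.Subset using (Subset)
import Data.Fin.Subset as Subset
open import Data.Fin.Subset.Properties using () renaming (_∈?_ to _∈ˢ?_)
open import Data.List.Base
  using (List; []; _∷_; _++_; map; length; foldr; replicate; upTo; applyUpTo; filter; deduplicate;
         concatMap; cartesianProduct; cartesianProductWith)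
open import Data.List.Membership.Propositional using (_∈_; _∉_; find; lose)
open import Data.List.Membership.Propositional.Properties
open import Data.List.Properties
  using (++-identityʳ; filter-++; filter-all; filter-none; length-++; length-applyUpTo; length-map;
         length-replicate; length-tabulate; length-upTo; map-++; map-id; map-id-local; map-replicate; map-∘)
open import Data.List.Relation.Binary.Permutation.Propositional
  using (_↭_; prep; swap; ↭-refl; ↭-reflexive; ↭-sym; ↭-trans; ↭-prep; ↭⇒↭ₛ; ↭⇒↭ₛ′)
open import Data.List.Relation.Binary.Permutation.Propositional.Properties
  using (All-resp-↭; ↭-length; ++⁺ˡ; ++⁺ʳ; ++-comm; shift; ∈-resp-↭; map⁺; filter-↭)
import Data.List.Relation.Binary.Permutation.Setoid.Properties as Permutationₛ
open import Data.List.Relation.Binary.Pointwise using (Pointwise-≡⇒≡)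
open import Data.List.Relation.Binary.Subset.Propositional using (_⊆_)
open import Data.List.Relation.Unary.All using (All; []; _∷_)
import Data.List.Relation.Unary.All as All
import Data.List.Relation.Unary.All.Properties as All
open import Data.List.Relation.Unary.AllPairs using ([]; _∷_)
open import Data.List.Relation.Unary.Any using (here; there; any?)
open import Data.List.Relation.Unary.Linked using (Linked; [])
open import Data.List.Relation.Unary.Sorted.TotalOrder.Properties using (↗↭↗⇒≋)
open import Data.List.Relation.Unary.Unique.DecPropositional.Properties using (deduplicate-!)
open import Data.List.Relation.Unary.Unique.Propositional using (Unique)
import Data.List.Relation.Unary.Unique.Propositional.Properties as Unique
open import Data.Nat.Base
open import Data.Nat.DivMod
open import Data.Nat.ListAction using (sum)
open import Data.Nat.ListAction.Properties using (sum-++; sum-↭)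
open import Data.Nat.Properties
open import Data.List.Sort ≤-decTotalOrder using (sort; sort-↭; sort-↗)
open import Data.Nat.Tactic.RingSolver using (solve-∀)
open import Data.Product.Base using (∃; ∃₂; _×_; _,_; proj₁; proj₂; uncurry)
open import Data.Sum.Base using (_⊎_; inj₁; inj₂)
open import Data.Vec.Base as Vec using (Vec; []; _∷_; lookup; updateAt; here; there)
import Data.Vec.Properties as Vec
open import Function.Base using (_∘_; id)
open import Function.Bundles using (_⇔_; mk⇔; module Equivalence)
open import Level using (0ℓ)
open import Relation.Binary.Definitions using (DecidableEquality; tri<; tri≈; tri>)
open import Relation.Binary.PropositionalEquality
  using (_≡_; _≢_; refl; sym; trans; cong; cong₂; subst; ≢-sym; isEquivalence; setoid; module ≡-Reasoning)
import Relation.Binary.Reasoning.Setoid as SetoidReasoning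
open import Relation.Nullary using (¬_; Dec; yes; no; does; contradiction; ¬?; _×-dec_; _→-dec_)
import Relation.Nullary.Decidable as Dec
open import Relation.Nullary.Decidable using (from-yes; does-⇔; dec-false)
open import Relation.Unary using (Decidable)
open import Defs

sum-replicate : ∀ c x → sum (replicate c x) ≡ c * x
sum-replicate zero    x = refl
sum-replicate (suc c) x = cong (x +_) (sum-replicate c x)

-- Subsums, zero-sum free lists and slow elements in a cancellative commutative monoid.

module Subsums {A : Set} (_≟_ : DecidableEquality A) {_∙_ : A → A → A} {ε : A}
  (isCommutativeMonoid : IsCommutativeMonoid _≡_ _∙_ ε)
  (cancelˡ : ∀ a {x y} → a ∙ x ≡ a ∙ y → x ≡ y) where

  commutativeMonoid : CommutativeMonoid 0ℓ 0ℓ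
  commutativeMonoid = record { isCommutativeMonoid = isCommutativeMonoid }

  open CommutativeMonoid commutativeMonoid
    using (assoc; comm; identityˡ; identityʳ; monoid; commutativeSemigroup)
  open CommutativeSemigroupProperties commutativeSemigroup using (x∙yz≈y∙xz)
  open Mult monoid using (×-homo-+; ×-homo-1) renaming (_×_ to infixr 25 _·_)
  open import Data.List.Membership.DecPropositional _≟_ using (_∈?_)

  infix 4 _∈Σ_ _∈Σ?_

  data _∈Σ_ : A → List A → Set where
    none : ε ∈Σ []
    skip : ∀ {x y ys} → x ∈Σ ys → x ∈Σ y ∷ ys
    pick : ∀ {x y ys} → x ∈Σ ys → y ∙ x ∈Σ y ∷ ys

  -- Each term is tested only against the subsums of the terms after it. This suffices, since every
  -- nonempty choice of terms has a first chosen one.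
  data ZeroFree : List A → Set where
    []  : ZeroFree []
    _∷_ : ∀ {y ys} → (∀ {x} → x ∈Σ ys → y ∙ x ≢ ε) → ZeroFree ys → ZeroFree (y ∷ ys)

  subsums : List A → List A
  subsums []       = ε ∷ []
  subsums (y ∷ ys) = subsums ys ++ map (y ∙_) (subsums ys)

  subsums⁺ : ∀ {x xs} → x ∈Σ xs → x ∈ subsums xs
  subsums⁺ none                = here refl
  subsums⁺ (skip x∈)           = ∈-++⁺ˡ (subsums⁺ x∈)
  subsums⁺ (pick {ys = ys} x∈) = ∈-++⁺ʳ (subsums ys) (∈-map⁺ _ (subsums⁺ x∈))

  subsums⁻ : ∀ {x} xs → x ∈ subsums xs → x ∈Σ xs
  subsums⁻ []       (here refl) = none
  subsums⁻ (y ∷ ys) x∈ with ∈-++⁻ (subsums ys) x∈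
  ... | inj₁ x∈ys = skip (subsums⁻ ys x∈ys)
  ... | inj₂ x∈y+ with z , z∈ , refl ← ∈-map⁻ (y ∙_) x∈y+ = pick (subsums⁻ ys z∈)

  _∈Σ?_ : ∀ x xs → Dec (x ∈Σ xs)
  x ∈Σ? xs = Dec.map′ (subsums⁻ xs) subsums⁺ (x ∈? subsums xs)

  total : List A → A
  total = foldr _∙_ ε

  ε∈Σ : ∀ xs → ε ∈Σ xs
  ε∈Σ []       = none
  ε∈Σ (x ∷ xs) = skip (ε∈Σ xs)

  total∈Σ : ∀ xs → total xs ∈Σ xs
  total∈Σ []       = none
  total∈Σ (x ∷ xs) = pick (total∈Σ xs)

  -- `z` is the sum of the terms left out.
  complement : ∀ {x xs} → x ∈Σ xs → ∃ λ z → z ∈Σ xs × x ∙ z ≡ total xs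
  complement none      = ε , none , identityˡ ε
  complement (skip x∈) with z , z∈ , eq ← complement x∈ =
    _ , pick z∈ , trans (x∙yz≈y∙xz _ _ z) (cong (_ ∙_) eq)
  complement (pick x∈) with z , z∈ , eq ← complement x∈ =
    z , skip z∈ , trans (assoc _ _ z) (cong (_ ∙_) eq)

  total-resp-↭ : ∀ {xs ys} → xs ↭ ys → total xs ≡ total ys
  total-resp-↭ _↭_.refl        = refl
  total-resp-↭ (prep x p)      = cong (x ∙_) (total-resp-↭ p)
  total-resp-↭ (swap x y p)    = trans (x∙yz≈y∙xz x y _) (cong (λ s → y ∙ (x ∙ s)) (total-resp-↭ p))
  total-resp-↭ (_↭_.trans p q) = trans (total-resp-↭ p) (total-resp-↭ q)

  ∈Σ-resp-↭ : ∀ {x xs ys} → xs ↭ ys → x ∈Σ xs → x ∈Σ ys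
  ∈Σ-resp-↭ _↭_.refl        x∈               = x∈
  ∈Σ-resp-↭ (prep x p)      (skip x∈)        = skip (∈Σ-resp-↭ p x∈)
  ∈Σ-resp-↭ (prep x p)      (pick x∈)        = pick (∈Σ-resp-↭ p x∈)
  ∈Σ-resp-↭ (swap x y p)    (skip (skip x∈)) = skip (skip (∈Σ-resp-↭ p x∈))
  ∈Σ-resp-↭ (swap x y p)    (skip (pick x∈)) = pick (skip (∈Σ-resp-↭ p x∈))
  ∈Σ-resp-↭ (swap x y p)    (pick (skip x∈)) = skip (pick (∈Σ-resp-↭ p x∈))
  ∈Σ-resp-↭ (swap x y p)    (pick (pick x∈)) =
    subst (_∈Σ _) (x∙yz≈y∙xz y x _) (pick (pick (∈Σ-resp-↭ p x∈)))
  ∈Σ-resp-↭ (_↭_.trans p q) x∈               = ∈Σ-resp-↭ q (∈Σ-resp-↭ p x∈)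

  ZeroFree-resp-↭ : ∀ {xs ys} → xs ↭ ys → ZeroFree xs → ZeroFree ys
  ZeroFree-resp-↭ _↭_.refl        zf             = zf
  ZeroFree-resp-↭ (prep x p)      (x+ ∷ zf)      =
    (λ z∈ → x+ (∈Σ-resp-↭ (↭-sym p) z∈)) ∷ ZeroFree-resp-↭ p zf
  ZeroFree-resp-↭ (swap {xs} {ys} x y p) (x+ ∷ y+ ∷ zf) =
    y+′ ∷ (λ z∈ → x+ (skip (∈Σ-resp-↭ (↭-sym p) z∈))) ∷ ZeroFree-resp-↭ p zf
    where
    y+′ : ∀ {z} → z ∈Σ x ∷ ys → y ∙ z ≢ ε
    y+′ (skip z∈) = y+ (∈Σ-resp-↭ (↭-sym p) z∈)
    y+′ (pick z∈) = x+ (pick (∈Σ-resp-↭ (↭-sym p) z∈)) ∘ trans (x∙yz≈y∙xz x y _)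
  ZeroFree-resp-↭ (_↭_.trans p q) zf             = ZeroFree-resp-↭ q (ZeroFree-resp-↭ p zf)

  ZeroFree-++⁻ʳ : ∀ xs {ys} → ZeroFree (xs ++ ys) → ZeroFree ys
  ZeroFree-++⁻ʳ []       zf       = zf
  ZeroFree-++⁻ʳ (x ∷ xs) (_ ∷ zf) = ZeroFree-++⁻ʳ xs zf

  ZeroFree⇒≢ε : ∀ {x xs} → ZeroFree (x ∷ xs) → x ≢ ε
  ZeroFree⇒≢ε {x} {xs} (x+ ∷ _) x≡ε = x+ (ε∈Σ xs) (trans (identityʳ x) x≡ε)

  ZeroFree⇒total≢ε : ∀ {x xs} → ZeroFree (x ∷ xs) → total (x ∷ xs) ≢ ε
  ZeroFree⇒total≢ε {xs = xs} (x+ ∷ _) = x+ (total∈Σ xs)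

  ∈⇒↭ : ∀ {a : A} {xs} → a ∈ xs → ∃ λ (ys : List A) → xs ↭ a ∷ ys
  ∈⇒↭ {a} a∈ with ys , zs , refl ← ∈-∃++ a∈ = ys ++ zs , shift a ys zs

  ZeroFree-pick : ∀ {c xs} {ys : List A} → c ∈ ys → ZeroFree (ys ++ xs) → ZeroFree (c ∷ xs)
  ZeroFree-pick {c} {xs} c∈ zf with ys′ , p ← ∈⇒↭ c∈ =
    ZeroFree-++⁻ʳ ys′ (ZeroFree-resp-↭ (↭-trans (++⁺ʳ xs p) (↭-sym (shift c ys′ xs))) zf)

  -- Translation by a maps the subsums other than the total to the subsums
  -- other than ε, i.e. adjoining a to xs creates only one new subsum.
  record Slow (xs : List A) (a : A) : Set where
    constructor slow
    field
      advance : ∀ {x} → x ∈Σ xs → x ≢ total xs → a ∙ x ∈Σ xs × a ∙ x ≢ ε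

  open Slow

  Slow-resp-↭ : ∀ {xs ys a} → xs ↭ ys → Slow xs a → Slow ys a
  Slow-resp-↭ {xs} {ys} {a} p s = slow advance′
    where
    advance′ : ∀ {x} → x ∈Σ ys → x ≢ total ys → a ∙ x ∈Σ ys × a ∙ x ≢ ε
    advance′ x∈ x≢ with a∙x∈ , a∙x≢ε ← advance s (∈Σ-resp-↭ (↭-sym p) x∈) (λ eq → x≢ (trans eq (total-resp-↭ p))) =
      ∈Σ-resp-↭ p a∙x∈ , a∙x≢ε

  -- By slowness, the only subsum of `a ∷ xs` that can be missing from `xs` is the new total. Any
  -- other one already comes from `xs`, so adding `a` to it amounts to picking the head.
  Slow-∷ : ∀ {xs a} → ZeroFree (a ∷ xs) → Slow xs a → Slow (a ∷ xs) a
  Slow-∷ {xs} {a} (a+ ∷ _) s = slow λ x∈ x≢ → pick (old x∈ x≢) , a+ (old x∈ x≢)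
    where
    old : ∀ {x} → x ∈Σ a ∷ xs → x ≢ total (a ∷ xs) → x ∈Σ xs
    old (skip x∈) _  = x∈
    old (pick x∈) x≢ = proj₁ (advance s x∈ (x≢ ∘ cong (a ∙_)))

  -- Subsums are symmetric under x ↦ total xs - x.
  Slow-predecessor : ∀ {xs a y} → Slow xs a → y ∈Σ xs → y ≢ ε →
                     ∃ λ z → z ∈Σ xs × z ≢ total xs × a ∙ z ≡ y
  Slow-predecessor {xs} {a} {y} s y∈ y≢ε
    with y′ , y′∈ , y+y′ ← complement y∈
    with ay′∈ , ay′≢ε ← advance s y′∈ (λ { refl →
           y≢ε (cancelˡ y′ (trans (comm y′ y) (trans y+y′ (sym (identityʳ _))))) })
    with z , z∈ , eq ← complement ay′∈ =
      z , z∈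
      , (λ { refl → ay′≢ε (cancelˡ z (trans (comm z _) (trans eq (sym (identityʳ _))))) })
      , cancelˡ y′ (begin
          y′ ∙ (a ∙ z)   ≡⟨ x∙yz≈y∙xz y′ a z ⟩
          a ∙ (y′ ∙ z)   ≡⟨ assoc a y′ z ⟨
          (a ∙ y′) ∙ z   ≡⟨ eq ⟩
          total xs       ≡⟨ y+y′ ⟨
          y ∙ y′         ≡⟨ comm y y′ ⟩
          y′ ∙ y         ∎)
    where open ≡-Reasoning

  -- Advancing from `ε` shows that `a` is a subsum, so `a ≡ c ∙ z` for a subsum `z`. If `z` is not
  -- `ε`, then `z ≡ a ∙ w` with `w` not the total. Cancelling `a` leaves `c ∙ w ≡ ε`, which slowness
  -- of `c` forbids.
  Slow-unique : ∀ {xs a c} → total xs ≢ ε → Slow xs a → Slow xs c → a ≡ c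
  Slow-unique {xs} {a} {c} t≢ε sᵃ sᶜ
    with a∈ , a≢ε ← advance sᵃ (ε∈Σ xs) (t≢ε ∘ sym)
    with z , z∈ , z≢ , cz≡a ← Slow-predecessor sᶜ (subst (_∈Σ xs) (identityʳ a) a∈) (a≢ε ∘ trans (identityʳ a))
    with z ≟ ε
  ... | yes refl = trans (sym cz≡a) (identityʳ c)
  ... | no z≢ε with w , w∈ , w≢ , aw≡z ← Slow-predecessor sᵃ z∈ z≢ε =
    contradiction
      (cancelˡ a (begin
        a ∙ (c ∙ w)   ≡⟨ x∙yz≈y∙xz a c w ⟩
        c ∙ (a ∙ w)   ≡⟨ cong (c ∙_) aw≡z ⟩
        c ∙ z         ≡⟨ cz≡a ⟩
        a             ≡⟨ identityʳ a ⟨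
        a ∙ ε         ∎))
      (proj₂ (advance sᶜ w∈ w≢))
    where open ≡-Reasoning

  -- Lists with at least twice as many subsums as terms.

  Rich : List A → Set
  Rich xs = ∃ λ us → Unique us × All (_∈Σ xs) us × 2 * length xs ≤ length us

  Rich-resp-↭ : ∀ {xs ys} → xs ↭ ys → Rich xs → Rich ys
  Rich-resp-↭ p (us , us! , us∈ , le) =
    us , us! , All.map (∈Σ-resp-↭ p) us∈ , subst (λ l → 2 * l ≤ length us) (↭-length p) le

  Rich-[_] : ∀ {x} → x ≢ ε → Rich (x ∷ [])
  Rich-[_] {x} x≢ε = ε ∷ x ∷ [] , ((x≢ε ∘ sym) ∷ []) ∷ [] ∷ []
    , skip none ∷ subst (_∈Σ _) (identityʳ x) (pick none) ∷ []
    , ≤-refl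

  -- One more term must bring two more subsums. Besides `c ∙ x`, the new total `c ∙ total xs` is
  -- always new: if it were a subsum of `xs`, its complement `z` would satisfy `c ∙ z ≡ ε`.
  Rich-∷ : ∀ {x c xs} → ZeroFree (c ∷ xs) → x ∈Σ xs → x ≢ total xs →
           ¬ (c ∙ x ∈Σ xs) → Rich xs → Rich (c ∷ xs)
  Rich-∷ {x} {c} {xs} (c+ ∷ _) x∈ x≢ cx∉ (us , us! , us∈ , le) =
    c ∙ total xs ∷ c ∙ x ∷ us
    , ((x≢ ∘ sym ∘ cancelˡ c) ∷ All.map (new ct∉) us∈) ∷ All.map (new cx∉) us∈ ∷ us!
    , pick (total∈Σ xs) ∷ pick x∈ ∷ All.map skip us∈
    , subst (_≤ 2 + length us) (sym (*-suc 2 (length xs))) (s≤s (s≤s le))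
    where
    new : ∀ {y} → ¬ (y ∈Σ xs) → ∀ {u} → u ∈Σ xs → y ≢ u
    new y∉ u∈ refl = y∉ u∈

    ct∉ : ¬ (c ∙ total xs ∈Σ xs)
    ct∉ ct∈ with z , z∈ , eq ← complement ct∈ =
      c+ z∈ (cancelˡ (total xs) (begin
        total xs ∙ (c ∙ z)   ≡⟨ x∙yz≈y∙xz _ c z ⟩
        c ∙ (total xs ∙ z)   ≡⟨ assoc c _ z ⟨
        (c ∙ total xs) ∙ z   ≡⟨ eq ⟩
        total xs             ≡⟨ identityʳ _ ⟨
        total xs ∙ ε         ∎))
      where open ≡-Reasoning

  -- Slowness is the absence of an `x` as demanded by `Rich-∷`; its condition `c ∙ x ≢ ε` comes for
  -- free from zero-sum freeness.
  grow-or-slow : ∀ {c xs} → ZeroFree (c ∷ xs) → Rich xs → Rich (c ∷ xs) ⊎ Slow xs c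
  grow-or-slow {c} {xs} zf@(c+ ∷ _) rich
    with any? (λ x → ¬? (x ≟ total xs) ×-dec ¬? (c ∙ x ∈Σ? xs)) (subsums xs)
  ... | yes any with x , x∈ , x≢ , cx∉ ← find any =
    inj₁ (Rich-∷ zf (subsums⁻ xs x∈) x≢ cx∉ rich)
  ... | no ¬any = inj₂ (slow stay)
    where
    stay : ∀ {x} → x ∈Σ xs → x ≢ total xs → c ∙ x ∈Σ xs × c ∙ x ≢ ε
    stay {x} x∈ x≢ with c ∙ x ∈Σ? xs
    ... | yes cx∈ = cx∈ , c+ x∈
    ... | no  cx∉ = contradiction (lose (subsums⁺ x∈) (x≢ , cx∉)) ¬any

  scan : ∀ {xs} → Rich xs → ∀ ys → (∀ {c} → c ∈ ys → ZeroFree (c ∷ xs)) →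
         (∃₂ λ c ys′ → ys ↭ c ∷ ys′ × Rich (c ∷ xs)) ⊎ All (Slow xs) ys
  scan rich []       zf = inj₂ []
  scan rich (y ∷ ys) zf with grow-or-slow (zf (here refl)) rich
  ... | inj₁ rich′ = inj₁ (y , ys , ↭-refl , rich′)
  ... | inj₂ s with scan rich ys (zf ∘ there)
  ...   | inj₁ (c , ys′ , p , rich′) =
            inj₁ (c , y ∷ ys′ , ↭-trans (↭-prep y p) (swap y c ↭-refl) , rich′)
  ...   | inj₂ ss = inj₂ (s ∷ ss)

  Slow-++ : ∀ {xs a} ys → ZeroFree (ys ++ xs) → All (_≡ a) ys → Slow xs a → Slow (ys ++ xs) a
  Slow-++ []       zf           []            s = s
  Slow-++ (y ∷ ys) zf@(_ ∷ zf′) (refl ∷ ys≡a) s = Slow-∷ zf (Slow-++ ys zf′ ys≡a s)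


  -- Subsums of lists made of multiples of one element.

  ·-∈Σ-replicate : ∀ a {i h} → i ≤ h → i · a ∈Σ replicate h a
  ·-∈Σ-replicate a {h = h} z≤n = ε∈Σ (replicate h a)
  ·-∈Σ-replicate a (s≤s i≤h)   = pick (·-∈Σ-replicate a i≤h)

  replicate-∈Σ : ∀ {x a xs} i → x ∈Σ replicate i a ++ xs → ∃₂ λ j z → j ≤ i × z ∈Σ xs × x ≡ j · a ∙ z
  replicate-∈Σ zero x∈ = 0 , _ , z≤n , x∈ , sym (identityˡ _)
  replicate-∈Σ (suc i) (skip x∈) with j , z , j≤i , z∈ , eq ← replicate-∈Σ i x∈ =
    j , z , m≤n⇒m≤1+n j≤i , z∈ , eq
  replicate-∈Σ {a = a} (suc i) (pick x∈) with j , z , j≤i , z∈ , eq ← replicate-∈Σ i x∈ =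
    suc j , z , s≤s j≤i , z∈ , trans (cong (a ∙_) eq) (sym (assoc a (j · a) z))

  ·-∸ : ∀ a {j i} → j ≤ i → i · a ≡ j · a ∙ (i ∸ j) · a
  ·-∸ a {j} {i} j≤i = trans (cong (_· a) (sym (m+[n∸m]≡n j≤i))) (×-homo-+ a j (i ∸ j))

  separate : ∀ a (xs : List A) → ∃₂ λ h ys → xs ↭ replicate h a ++ ys × a ∉ ys
  separate a [] = 0 , [] , ↭-refl , λ ()
  separate a (x ∷ xs) with h , ys , p , a∉ ← separate a xs | x ≟ a
  ... | yes refl = suc h , ys , prep x p , a∉
  ... | no x≢a = h , x ∷ ys , ↭-trans (prep x p) (↭-sym (shift x (replicate h a) ys))
               , λ { (here refl) → x≢a refl ; (there a∈) → a∉ a∈ }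

  ∈Σ-++⁺ˡ : ∀ {x xs} ys → x ∈Σ xs → x ∈Σ xs ++ ys
  ∈Σ-++⁺ˡ ys none      = ε∈Σ ys
  ∈Σ-++⁺ˡ ys (skip x∈) = skip (∈Σ-++⁺ˡ ys x∈)
  ∈Σ-++⁺ˡ ys (pick x∈) = pick (∈Σ-++⁺ˡ ys x∈)

  total-replicate-++ : ∀ i a xs → total (replicate i a ++ xs) ≡ i · a ∙ total xs
  total-replicate-++ zero    a xs = sym (identityˡ _)
  total-replicate-++ (suc i) a xs =
    trans (cong (a ∙_) (total-replicate-++ i a xs)) (sym (assoc a _ _))

  -- The copies of `a` are adjoined to `t` one by one, `h` staying fixed. The next copy creates the
  -- new total and also `(i + 1) · a`. Were the latter equal to `j · a` or `j · a ∙ t` with `j ≤ i`,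
  -- then `(i + 1 - j) · a` would be `ε`, against zero-sum freeness, or `t`, against the hypothesis
  -- on `t`.
  Rich-replicate : ∀ {t a h} i → i ≤ h → ZeroFree (replicate i a ++ t ∷ []) →
                   (∀ {j} → j ≤ h → t ≢ j · a) → Rich (replicate i a ++ t ∷ [])
  Rich-replicate zero i≤h zf t≢ = Rich-[ t≢ z≤n ]
  Rich-replicate {t} {a} {h} (suc i) i<h zf@(a+ ∷ zf′) t≢ =
    Rich-∷ {x = i · a} zf (∈Σ-++⁺ˡ {xs = replicate i a} _ (·-∈Σ-replicate a ≤-refl)) ia≢ [1+i]a∉
      (Rich-replicate i (≤-trans (n≤1+n i) i<h) zf′ t≢)
    where
    ia≢ : i · a ≢ total (replicate i a ++ t ∷ [])
    ia≢ eq = t≢ z≤n (trans (sym (identityʳ t))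
      (sym (cancelˡ (i · a) (trans (identityʳ _) (trans eq (total-replicate-++ i a _))))))

    difference : ∀ {j z} → j ≤ i → a ∙ i · a ≡ j · a ∙ z → (suc i ∸ j) · a ≡ z
    difference {j} j≤i eq =
      cancelˡ (j · a) (trans (sym (·-∸ a (m≤n⇒m≤1+n j≤i))) eq)

    [1+i]a∉ : ¬ (a ∙ i · a ∈Σ replicate i a ++ t ∷ [])
    [1+i]a∉ x∈ with replicate-∈Σ i x∈
    ... | j , _ , j≤i , pick none , eq =
      t≢ (≤-trans (m∸n≤m (suc i) j) i<h) (sym (trans (difference j≤i eq) (identityʳ t)))
    ... | j , _ , j≤i , skip none , eq =
      a+ (∈Σ-++⁺ˡ _ (·-∈Σ-replicate a (m∸n≤m i j)))
         (trans (cong (_· a) (sym (+-∸-assoc 1 j≤i))) (difference j≤i eq))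

  -- The `h` copies of `a` reach every multiple from `0` to `h`. Adjoining `j · a` extends an
  -- initial segment `0 … s` to `0 … s + j` without a gap, because `j ≤ h ≤ s`.
  interval : ∀ {a h js} → All (_≤ h) js → ∀ {i} → i ≤ sum js + h →
             i · a ∈Σ map (_· a) js ++ replicate h a
  interval []                  i≤ = ·-∈Σ-replicate _ i≤
  interval {a} {h} {j ∷ js} (j≤h ∷ js≤h) {i} i≤ with i ≤? sum js + h
  ... | yes i≤′ = skip (interval js≤h i≤′)
  ... | no  i≰  = subst (_∈Σ _) (sym (·-∸ a j≤i)) (pick (interval js≤h i∸j≤))
    where
    j≤i : j ≤ i
    j≤i = ≤-trans j≤h (≤-trans (m≤n+m h (sum js)) (≤-trans (n≤1+n _) (≰⇒> i≰)))
    i∸j≤ : i ∸ j ≤ sum js + h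
    i∸j≤ = ≤-trans (∸-monoˡ-≤ j (≤-trans i≤ (≤-reflexive (+-assoc j _ h)))) (≤-reflexive (m+n∸m≡n j _))

  -- Follow the weight as terms are adjoined. If `j · a` carried it from below `o` to `o` or beyond,
  -- then `o ∸ j` would lie in the segment covered by `interval`, and that subsum together with
  -- `j · a` would give `o · a ≡ ε`.
  weight< : ∀ {a h o} js → ZeroFree (map (_· a) js ++ replicate h a) → All (_≤ h) js →
            0 < o → o · a ≡ ε → sum js + h < o
  weight< {h = zero} [] zf [] 0<o oa≡ε = 0<o
  weight< {a} {suc h} {o} [] zf@(a+ ∷ zf′) [] 0<o oa≡ε
    with m≤n⇒m<n∨m≡n (weight< {a} {h} [] zf′ [] 0<o oa≡ε)
  ... | inj₁ h+1<o = h+1<o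
  -- A copy of `a` raises the weight by one only, so `o` could not be passed without being hit
  -- exactly.
  ... | inj₂ refl  = contradiction oa≡ε (a+ (·-∈Σ-replicate a ≤-refl))
  weight< {a} {h} {o} (j ∷ js) (j+ ∷ zf) (j≤h ∷ js≤h) 0<o oa≡ε
    with w<o ← weight< js zf js≤h 0<o oa≡ε
    with suc (j + sum js + h) ≤? o
  ... | yes <o = <o
  ... | no  ≮o = contradiction (trans (sym (·-∸ a j≤o)) oa≡ε) (j+ (interval js≤h o∸j≤))
    where
    j≤o : j ≤ o
    j≤o = ≤-trans j≤h (≤-trans (m≤n+m h (sum js)) (≤-trans (n≤1+n _) w<o))
    o∸j≤ : o ∸ j ≤ sum js + h
    o∸j≤ = ≤-trans (∸-monoˡ-≤ j (≤-trans (≤-pred (≰⇒> ≮o)) (≤-reflexive (+-assoc j _ h))))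
                   (≤-reflexive (m+n∸m≡n j _))

  -- The structure of long zero-sum free lists.

  module _ (n : ℕ) (bound : ∀ {us : List A} → Unique us → length us ≤ n) where

    -- The rich part `x ∷ xs` absorbs terms of the pool `ys`, whose length `m` decreases. Once
    -- stuck, all of `ys` is slow for the rich part and hence constant by `Slow-unique`; this uses a
    -- nonzero total, so the rich part is kept nonempty. That the slow element lies in the pool is
    -- what `small-multiples` later contradicts.
    exists-Slow : ∀ m x xs ys → length ys ≡ m → Rich (x ∷ xs) → ZeroFree (ys ++ x ∷ xs) →
                  n < 2 * length (ys ++ x ∷ xs) → ∃ λ a → a ∈ ys × Slow (ys ++ x ∷ xs) a
    exists-Slow m x xs ys |ys| rich zf n<
      with scan rich ys (λ c∈ → ZeroFree-pick c∈ zf)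
    -- With an empty pool the whole list is rich, so twice its length is at most `n`.
    exists-Slow m x xs [] |ys| (us , us! , _ , le) zf n< | inj₂ ss =
      contradiction (≤-trans le (bound us!)) (<⇒≱ n<)
    exists-Slow m x xs (a ∷ ys) |ys| rich zf n< | inj₂ (s ∷ ss) =
      a , here refl , Slow-++ (a ∷ ys) zf (refl ∷ All.map (λ s′ → Slow-unique t≢ε s′ s) ss) s
      where
      t≢ε : total (x ∷ xs) ≢ ε
      t≢ε = ZeroFree⇒total≢ε (ZeroFree-++⁻ʳ (a ∷ ys) zf)
    exists-Slow zero x xs ys |ys| rich zf n< | inj₁ (c , ys′ , p , rich′)
      with () ← trans (sym |ys|) (↭-length p)
    exists-Slow (suc m) x xs ys |ys| rich zf n< | inj₁ (c , ys′ , p , rich′)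
      with q ← ↭-trans (++⁺ʳ (x ∷ xs) p) (↭-sym (shift c ys′ (x ∷ xs)))
      with a , a∈ , s ← exists-Slow m c (x ∷ xs) ys′
             (suc-injective (trans (sym (↭-length p)) |ys|)) rich′
             (ZeroFree-resp-↭ q zf) (subst (λ l → n < 2 * l) (↭-length q) n<)
      = a , ∈-resp-↭ (↭-sym p) (there a∈) , Slow-resp-↭ (↭-sym q) s

    -- A sequence containing all copies of the slow element a and an element
    -- that is not a small multiple of a is rich, so there would be a slow
    -- element outside it.
    small-multiples : ∀ {xs a h ys} → ZeroFree xs → n < 2 * length xs → total xs ≢ ε →
                      Slow xs a → xs ↭ replicate h a ++ ys → a ∉ ys →
                      ∀ {t} → t ∈ ys → t ∈ map (_· a) (upTo (suc h))
    small-multiples {xs} {a} {h} {ys} zf n< t≢ε s p a∉ {t} t∈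
      with t ∈? map (_· a) (upTo (suc h))
    ... | yes t∈′ = t∈′
    ... | no  t∉
      with ys′ , q ← ∈⇒↭ t∈
      with r ← ↭-trans p (↭-trans (++⁺ˡ (replicate h a) q) (++-comm (replicate h a) (t ∷ ys′)))
      with r′ ← ↭-trans r (↭-trans (↭-prep t (++-comm ys′ (replicate h a))) (++-comm (t ∷ replicate h a) ys′))
      with t∷ ← ++-comm (replicate h a) (t ∷ [])
      with zf′ ← ZeroFree-resp-↭ r′ zf
      with c , c∈ , sᶜ ← exists-Slow _ t (replicate h a) ys′ refl
             (Rich-resp-↭ t∷ (Rich-replicate h ≤-refl
               (ZeroFree-resp-↭ (↭-sym t∷) (ZeroFree-++⁻ʳ ys′ zf′))
               (λ {j} j≤h eq → t∉ (subst (_∈ _) (sym eq) (∈-map⁺ (_· a) (∈-upTo⁺ (s≤s j≤h)))))))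
             zf′ (subst (λ l → n < 2 * l) (↭-length r′) n<)
      with refl ← Slow-unique t≢ε (Slow-resp-↭ (↭-sym r′) sᶜ) s
      = contradiction (∈-resp-↭ (↭-sym q) (there c∈)) a∉

    coefficients : ∀ {a h ys} → (∀ {t} → t ∈ ys → t ∈ map (_· a) (upTo (suc h)) × t ≢ ε) →
                   ∃ λ js → ys ≡ map (_· a) js × All (0 <_) js × All (_≤ h) js
    coefficients {ys = []} f = [] , refl , [] , []
    coefficients {a} {ys = y ∷ ys} f
      with js , refl , 0<js , js≤h ← coefficients {ys = ys} (f ∘ there)
      with y∈ , y≢ε ← f (here refl)
      with ∈-map⁻ (_· a) y∈
    ... | zero  , _  , refl = contradiction refl y≢ε
    ... | suc j , j∈ , refl = suc j ∷ js , refl , s≤s z≤n ∷ 0<js , ≤-pred (∈-upTo⁻ j∈) ∷ js≤h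

    -- The process starts from the first term alone, whose subsums are `ε` and `x`. The `h` copies
    -- of the slow element get coefficient 1, and `small-multiples` bounds the other coefficients by
    -- `h`, as `weight<` requires. The last component covers every `o` that annihilates `a`, since
    -- it later serves both to bound the coefficient sum and to show that `a` generates.
    long⇒multiples : ∀ {xs} → ZeroFree xs → 0 < length xs → n < 2 * length xs →
      ∃₂ λ a js → xs ↭ map (_· a) js × All (0 <_) js × (∀ {o} → 0 < o → o · a ≡ ε → sum js < o)
    long⇒multiples {x ∷ xs} zf _ n<
      with zf∷ʳ ← ZeroFree-resp-↭ (++-comm (x ∷ []) xs) zf
      with a , _ , s′ ← exists-Slow _ x [] xs refl (Rich-[ ZeroFree⇒≢ε zf ]) zf∷ʳ
             (subst (λ l → n < 2 * l) (↭-length (++-comm (x ∷ []) xs)) n<)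
      with s ← Slow-resp-↭ (++-comm xs (x ∷ [])) s′
      with h , ys , p , a∉ ← separate a (x ∷ xs)
      with zf′ ← ZeroFree-resp-↭ p zf
      with js , refl , 0<js , js≤h ← coefficients {a} {h} {ys} (λ t∈ →
             small-multiples zf n< (ZeroFree⇒total≢ε zf) s p a∉ t∈
             , ZeroFree⇒≢ε (ZeroFree-pick {xs = []} t∈
                 (subst ZeroFree (sym (++-identityʳ ys)) (ZeroFree-++⁻ʳ (replicate h a) zf′))))
      = a , js ++ replicate h 1
      , ↭-trans p (↭-trans (++-comm (replicate h a) _) (↭-reflexive (sym (begin
          map (_· a) (js ++ replicate h 1)                ≡⟨ map-++ (_· a) js _ ⟩
          map (_· a) js ++ map (_· a) (replicate h 1)     ≡⟨ cong (map (_· a) js ++_) (map-replicate (_· a) h 1) ⟩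
          map (_· a) js ++ replicate h (1 · a)            ≡⟨ cong (λ b → map (_· a) js ++ replicate h b) (×-homo-1 a) ⟩
          map (_· a) js ++ replicate h a                  ∎))))
      , All.++⁺ 0<js (All.replicate⁺ h (s≤s z≤n))
      , λ 0<o oa≡ε → subst (_< _)
          (sym (trans (sum-++ js _) (cong (sum js +_) (trans (sum-replicate h 1) (*-identityʳ h)))))
          (weight< js (ZeroFree-resp-↭ (++-comm (replicate h a) _) zf′) js≤h 0<o oa≡ε)
      where
      open ≡-Reasoning

Unique-⊆⇒length≤ : ∀ {A : Set} {xs ys : List A} → Unique xs → xs ⊆ ys → length xs ≤ length ys
Unique-⊆⇒length≤ [] xs⊆ys = z≤n
Unique-⊆⇒length≤ {xs = x ∷ xs} {ys} (x≢ ∷ xs!) xs⊆ys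
  with as , bs , refl ← ∈-∃++ (xs⊆ys (here refl)) =
    subst (suc (length xs) ≤_) (sym (↭-length (shift x as bs))) (s≤s (Unique-⊆⇒length≤ xs! ⊆′))
  where
  ⊆′ : xs ⊆ as ++ bs
  ⊆′ z∈ with ∈-resp-↭ (shift x as bs) (xs⊆ys (there z∈))
  ... | here refl = contradiction refl (All.lookup x≢ z∈)
  ... | there z∈′ = z∈′

-- Cyclic groups: orders, generators and behaving sequences.

module Cyclic (n : ℕ) .{{_ : NonZero n}} where

  open RawMonoid (C n) using (_∙_; ε)

  toℕ-mod : ∀ m → toℕ (m mod n) ≡ m % n
  toℕ-mod m = Fin.toℕ-fromℕ< _

  %-+ˡ : ∀ m k → (m % n + k) % n ≡ (m + k) % n
  %-+ˡ m k = begin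
    (m % n + k) % n           ≡⟨ %-distribˡ-+ (m % n) k n ⟩
    (m % n % n + k % n) % n   ≡⟨ cong (λ r → (r + k % n) % n) (m%n%n≡m%n m n) ⟩
    (m % n + k % n) % n       ≡⟨ %-distribˡ-+ m k n ⟨
    (m + k) % n               ∎
    where open ≡-Reasoning

  %-+ʳ : ∀ m k → (k + m % n) % n ≡ (k + m) % n
  %-+ʳ m k = trans (cong (_% n) (+-comm k _)) (trans (%-+ˡ m k) (cong (_% n) (+-comm m k)))

  toℕ% : ∀ (a : Fin n) → toℕ a % n ≡ toℕ a
  toℕ% a = m<n⇒m%n≡m (Fin.toℕ<n a)

  abstract

    ∙-comm : ∀ a b → a ∙ b ≡ b ∙ a
    ∙-comm a b = cong (_mod n) (+-comm (toℕ a) (toℕ b))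

    ∙-assoc : ∀ a b c → (a ∙ b) ∙ c ≡ a ∙ (b ∙ c)
    ∙-assoc a b c = Fin.toℕ-injective (begin
      toℕ ((a ∙ b) ∙ c)                       ≡⟨ toℕ-mod _ ⟩
      (toℕ (a ∙ b) + toℕ c) % n               ≡⟨ cong (λ s → (s + toℕ c) % n) (toℕ-mod _) ⟩
      ((toℕ a + toℕ b) % n + toℕ c) % n       ≡⟨ %-+ˡ (toℕ a + toℕ b) (toℕ c) ⟩
      (toℕ a + toℕ b + toℕ c) % n             ≡⟨ cong (_% n) (+-assoc (toℕ a) _ _) ⟩
      (toℕ a + (toℕ b + toℕ c)) % n           ≡⟨ %-+ʳ (toℕ b + toℕ c) (toℕ a) ⟨
      (toℕ a + (toℕ b + toℕ c) % n) % n       ≡⟨ cong (λ s → (toℕ a + s) % n) (toℕ-mod _) ⟨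
      (toℕ a + toℕ (b ∙ c)) % n               ≡⟨ toℕ-mod _ ⟨
      toℕ (a ∙ (b ∙ c))                       ∎)
      where open ≡-Reasoning

    ∙-identityˡ : ∀ a → ε ∙ a ≡ a
    ∙-identityˡ a = Fin.toℕ-injective (begin
      toℕ (ε ∙ a)             ≡⟨ toℕ-mod _ ⟩
      (toℕ ε + toℕ a) % n     ≡⟨ cong (λ s → (s + toℕ a) % n) (toℕ-mod 0) ⟩
      (0 % n + toℕ a) % n     ≡⟨ %-+ˡ 0 (toℕ a) ⟩
      toℕ a % n               ≡⟨ toℕ% a ⟩
      toℕ a                   ∎)
      where open ≡-Reasoning

    ∙-cancelˡ : ∀ a {x y} → a ∙ x ≡ a ∙ y → x ≡ y
    ∙-cancelˡ a {x} {y} eq = Fin.toℕ-injective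
      (trans (sym (undo x)) (trans (cong (λ s → (n ∸ toℕ a + toℕ s) % n) eq) (undo y)))
      where
      undo : ∀ z → (n ∸ toℕ a + toℕ (a ∙ z)) % n ≡ toℕ z
      undo z = begin
        (n ∸ toℕ a + toℕ (a ∙ z)) % n             ≡⟨ cong (λ s → (n ∸ toℕ a + s) % n) (toℕ-mod _) ⟩
        (n ∸ toℕ a + (toℕ a + toℕ z) % n) % n     ≡⟨ %-+ʳ (toℕ a + toℕ z) (n ∸ toℕ a) ⟩
        (n ∸ toℕ a + (toℕ a + toℕ z)) % n         ≡⟨ cong (_% n) (+-assoc (n ∸ toℕ a) _ _) ⟨
        (n ∸ toℕ a + toℕ a + toℕ z) % n           ≡⟨ cong (λ s → (s + toℕ z) % n) (m∸n+n≡m (<⇒≤ (Fin.toℕ<n a))) ⟩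
        (n + toℕ z) % n                           ≡⟨ cong (_% n) (+-comm n _) ⟩
        (toℕ z + n) % n                           ≡⟨ [m+n]%n≡m%n (toℕ z) n ⟩
        toℕ z % n                                 ≡⟨ toℕ% z ⟩
        toℕ z                                     ∎
        where open ≡-Reasoning

  isCommutativeMonoid : IsCommutativeMonoid _≡_ _∙_ ε
  isCommutativeMonoid = record
    { isMonoid = record
      { isSemigroup = record
        { isMagma = record { isEquivalence = isEquivalence ; ∙-cong = cong₂ _∙_ }
        ; assoc = ∙-assoc }
      ; identity = ∙-identityˡ , λ a → trans (∙-comm a ε) (∙-identityˡ a) }
    ; comm = ∙-comm }

  open Subsums Fin._≟_ isCommutativeMonoid ∙-cancelˡ public
  open CommutativeMonoid commutativeMonoid using (identityʳ; monoid)
  open Mult monoid using (×-homo-+; ×-assocˡ) renaming (_×_ to infixr 25 _·_) public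

  bound : ∀ {us : List (Fin n)} → Unique us → length us ≤ n
  bound us! = ≤-trans (Unique-⊆⇒length≤ us! (λ _ → ∈-allFin _)) (≤-reflexive (length-tabulate id))

  ·-ε : ∀ m → m · ε ≡ ε
  ·-ε zero    = refl
  ·-ε (suc m) = trans (∙-identityˡ _) (·-ε m)

  n·≡ε : ∀ a → n · a ≡ ε
  n·≡ε a = Fin.toℕ-injective (trans (toℕ-· n n a) (trans (cong (_% n) (*-comm n _))
    (trans (m*n%n≡0 (toℕ a) n) (sym (trans (toℕ-mod 0) 0%n≡0)))))
    where
    0%n≡0 : 0 % n ≡ 0
    0%n≡0 = m<n⇒m%n≡m (>-nonZero⁻¹ n)

  ·-cancel : ∀ {a i j} → i ≤ j → i · a ≡ j · a → (j ∸ i) · a ≡ ε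
  ·-cancel {a} {i} {j} i≤j eq =
    sym (∙-cancelˡ (i · a) (trans (identityʳ _) (trans eq (·-∸ a i≤j))))

  -- Write the residue 1 as `m · g`. Then `o` times it is `m · o · g ≡ ε`, whereas for `0 < o < n`
  -- it is the nonzero residue `o`.
  generator-order : ∀ {g o} → IsGenerator n g → 0 < o → o · g ≡ ε → n ≤ o
  generator-order {g} {o} gen 0<o og≡ε with n ≤? o
  ... | yes n≤o = n≤o
  ... | no  n≰o with m , mg≡1 ← gen (1 mod n) = contradiction (begin-strict
    0                       <⟨ 0<o ⟩
    o                       ≡⟨ m<n⇒m%n≡m (≰⇒> n≰o) ⟨
    o % n                   ≡⟨ cong (_% n) (*-identityʳ o) ⟨
    (o * 1) % n             ≡⟨ o*1 ⟩
    toℕ (o · (1 mod n))     ≡⟨ cong (λ x → toℕ (o · x)) mg≡1 ⟨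
    toℕ (o · m · g)         ≡⟨ cong toℕ (×-assocˡ g o m) ⟩
    toℕ ((o * m) · g)       ≡⟨ cong (λ i → toℕ (i · g)) (*-comm o m) ⟩
    toℕ ((m * o) · g)       ≡⟨ cong toℕ (×-assocˡ g m o) ⟨
    toℕ (m · o · g)         ≡⟨ cong (λ x → toℕ (m · x)) og≡ε ⟩
    toℕ (m · ε)             ≡⟨ cong toℕ (·-ε m) ⟩
    toℕ ε                   ≡⟨ toℕ-mod 0 ⟩
    0 % n                   ≡⟨ m<n⇒m%n≡m (>-nonZero⁻¹ n) ⟩
    0                       ∎) (<-irrefl refl)
    where
    open ≤-Reasoning
    o*1 : (o * 1) % n ≡ toℕ (o · (1 mod n))
    o*1 = trans (%-distribˡ-* o 1 n) (trans (cong (λ s → (o % n * s) % n) (sym (m%n%n≡m%n 1 n)))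
      (trans (sym (%-distribˡ-* o (1 % n) n)) (trans (cong (λ s → (o * s) % n) (sym (toℕ-mod 1)))
      (sym (toℕ-· n o (1 mod n))))))

  ·-injective : ∀ {g i j} → IsGenerator n g → i < n → j < n → i · g ≡ j · g → i ≡ j
  ·-injective {g} {i} {j} gen i<n j<n eq with <-cmp i j
  ... | tri≈ _ i≡j _ = i≡j
  ... | tri< i<j _ _ = contradiction (generator-order gen (m<n⇒0<n∸m i<j) (·-cancel (<⇒≤ i<j) eq))
                                     (<⇒≱ (≤-<-trans (m∸n≤m j i) j<n))
  ... | tri> _ _ j<i = contradiction (generator-order gen (m<n⇒0<n∸m j<i) (·-cancel (<⇒≤ j<i) (sym eq)))
                                     (<⇒≱ (≤-<-trans (m∸n≤m i j) i<n))

  -- Pigeonhole: the multiples `i · a` with `i < n` are distinct, so an element missed by them would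
  -- be one too many.
  order⇒generator : ∀ {a} → (∀ {o} → 0 < o → o < n → o · a ≢ ε) → IsGenerator n a
  order⇒generator {a} free x with any? (x Fin.≟_) (applyUpTo (_· a) n)
  ... | yes x∈ with m , _ , refl ← ∈-applyUpTo⁻ (_· a) x∈ = m , refl
  ... | no  x∉ = contradiction
    (≤-trans (≤-reflexive (cong suc (sym (length-applyUpTo (_· a) n)))) (bound x∷!)) 1+n≰n
    where
    distinct : ∀ {i j} → i < j → j < n → i · a ≢ j · a
    distinct {i} {j} i<j j<n eq =
      free (m<n⇒0<n∸m i<j) (≤-<-trans (m∸n≤m j i) j<n) (·-cancel (<⇒≤ i<j) eq)

    x∷! : Unique (x ∷ applyUpTo (_· a) n)
    x∷! = All.tabulate (λ { x∈ refl → x∉ x∈ }) ∷ Unique.applyUpTo⁺₁ (_· a) n distinct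

  -- In standard terms, the index of the sequence is less than 1.
  Behaving : List (Fin n) → Set
  Behaving xs = ∃₂ λ g js → IsGenerator n g × xs ↭ map (_· g) js × All (0 <_) js × sum js < n

  long⇒behaving : ∀ {xs} → ZeroFree xs → n < 2 * length xs → Behaving xs
  long⇒behaving {xs} zf n<
    with a , js , p , 0<js , <o ← long⇒multiples n bound zf (*-cancelˡ-< 2 0 _ (≤-<-trans z≤n n<)) n< =
      a , js , order⇒generator free , p , 0<js , <o (>-nonZero⁻¹ n) (n·≡ε a)
    where
    length≤ : length xs ≤ sum js
    length≤ = subst (_≤ sum js) (trans (sym (length-map (_· a) js)) (sym (↭-length p))) (length≤sum 0<js)

    -- If o a = 0 then also (n - o) a = 0, and both o and n - o exceed sum js.
    free : ∀ {o} → 0 < o → o < n → o · a ≢ ε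
    free {o} 0<o o<n oa≡ε = <⇒≱ n< (begin
      2 * length xs           ≡⟨ cong (length xs +_) (+-identityʳ _) ⟩
      length xs + length xs   ≤⟨ +-mono-≤ (≤-trans length≤ (<⇒≤ (<o 0<o oa≡ε)))
                                          (≤-trans length≤ (<⇒≤ (<o (m<n⇒0<n∸m o<n) n∸o))) ⟩
      o + (n ∸ o)             ≡⟨ m+[n∸m]≡n (<⇒≤ o<n) ⟩
      n                       ∎)
      where
      open ≤-Reasoning
      n∸o : (n ∸ o) · a ≡ ε
      n∸o = ·-cancel (<⇒≤ o<n) (trans oa≡ε (sym (n·≡ε a)))

  -- A nonempty subsum is `i · g` with `0 < i ≤ sum js < n`, hence nonzero by `generator-order`.
  behaving⇒ZeroFree : ∀ {g} js → IsGenerator n g → All (0 <_) js → sum js < n → ZeroFree (map (_· g) js)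
  behaving⇒ZeroFree {g} []       gen []           _  = []
  behaving⇒ZeroFree {g} (j ∷ js) gen (0<j ∷ 0<js) <n =
    nonzero ∷ behaving⇒ZeroFree js gen 0<js (≤-<-trans (m≤n+m _ j) <n)
    where
    multiple : ∀ {x} js → x ∈Σ map (_· g) js → ∃ λ i → i ≤ sum js × x ≡ i · g
    multiple []       none      = 0 , z≤n , refl
    multiple (j ∷ js) (skip x∈) with i , i≤ , eq ← multiple js x∈ = i , ≤-trans i≤ (m≤n+m _ j) , eq
    multiple (j ∷ js) (pick x∈) with i , i≤ , refl ← multiple js x∈ =
      j + i , +-monoʳ-≤ j i≤ , sym (×-homo-+ g j i)

    nonzero : ∀ {x} → x ∈Σ map (_· g) js → j · g ∙ x ≢ ε
    nonzero x∈ eq with i , i≤ , refl ← multiple js x∈ =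
      <⇒≱ <n (≤-trans (generator-order gen (≤-trans 0<j (m≤m+n j i)) (trans (×-homo-+ g j i) eq)) (+-monoʳ-≤ j i≤))


-- The cases `(2 , 0)` and `(4 , 1)`, where 2ℓ = n.

module _ where

  open Cyclic 2

  singleton-behaving : ∀ x → ZeroFree (x ∷ []) → Behaving (x ∷ [])
  singleton-behaving 0F (x+ ∷ []) = contradiction refl (x+ none)
  singleton-behaving 1F _         =
    1F , 1 ∷ [] , from-yes (isGenerator? 2 1F) , ↭-refl , s≤s z≤n ∷ [] , s≤s (s≤s z≤n)

module _ where

  open Cyclic 4

  -- As `2 + 2 = 0` and `1 + 3 = 0` in `C 4`, exactly one of the values 1 and 3 occurs in a zero-sum
  -- free pair. It serves as the generator, and 2 is twice either of them.
  pair-behaving : ∀ x y → ZeroFree (x ∷ y ∷ []) → Behaving (x ∷ y ∷ [])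
  pair-behaving 0F y  (x+ ∷ _)      = contradiction refl (x+ (skip none))
  pair-behaving 1F 0F (_ ∷ y+ ∷ []) = contradiction refl (y+ none)
  pair-behaving 2F 0F (_ ∷ y+ ∷ []) = contradiction refl (y+ none)
  pair-behaving 3F 0F (_ ∷ y+ ∷ []) = contradiction refl (y+ none)
  pair-behaving 1F 3F (x+ ∷ _)      = contradiction refl (x+ (pick none))
  pair-behaving 2F 2F (x+ ∷ _)      = contradiction refl (x+ (pick none))
  pair-behaving 3F 1F (x+ ∷ _)      = contradiction refl (x+ (pick none))
  pair-behaving 1F 1F _ =
    1F , 1 ∷ 1 ∷ [] , from-yes (isGenerator? 4 1F) , ↭-refl , s≤s z≤n ∷ s≤s z≤n ∷ [] , from-yes (3 ≤? 4)
  pair-behaving 1F 2F _ =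
    1F , 1 ∷ 2 ∷ [] , from-yes (isGenerator? 4 1F) , ↭-refl , s≤s z≤n ∷ s≤s z≤n ∷ [] , from-yes (4 ≤? 4)
  pair-behaving 2F 1F _ =
    1F , 2 ∷ 1 ∷ [] , from-yes (isGenerator? 4 1F) , ↭-refl , s≤s z≤n ∷ s≤s z≤n ∷ [] , from-yes (4 ≤? 4)
  pair-behaving 2F 3F _ =
    3F , 2 ∷ 1 ∷ [] , from-yes (isGenerator? 4 3F) , ↭-refl , s≤s z≤n ∷ s≤s z≤n ∷ [] , from-yes (4 ≤? 4)
  pair-behaving 3F 2F _ =
    3F , 1 ∷ 2 ∷ [] , from-yes (isGenerator? 4 3F) , ↭-refl , s≤s z≤n ∷ s≤s z≤n ∷ [] , from-yes (4 ≤? 4)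
  pair-behaving 3F 3F _ =
    3F , 1 ∷ 1 ∷ [] , from-yes (isGenerator? 4 3F) , ↭-refl , s≤s z≤n ∷ s≤s z≤n ∷ [] , from-yes (3 ≤? 4)

-- For `(3 , 1)` the sequence has one term, so the partition `1` leaves no copy of `g`, and `2 g`
-- would be counted for both generators. For `(6 , 2)` the zero-sum free sequence with terms 2, 2, 3
-- is not behaving.
record Admissible (n k : ℕ) : Set where
  constructor admissible
  field
    n≥2  : 2 ≤ n
    k≤   : 3 * k ≤ n
    ≢3,1 : ¬ (n ≡ 3 × k ≡ 1)
    ≢6,2 : ¬ (n ≡ 6 × k ≡ 2)

-- For ℓ = n - 1 - k the first alternative says 2ℓ > n. Otherwise `3 * k ≤ n ≤ 2 + 2 * k`, so
-- `k ≤ 2`, and the only pairs are `(2 , 0)`, `(3 , 1)`, `(4 , 1)` and `(6 , 2)`.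
2+2k-cases : ∀ {n k} → Admissible n k →
             2 + 2 * k < n ⊎ (n ≡ 2 × k ≡ 0) ⊎ (n ≡ 4 × k ≡ 1)
2+2k-cases {n} {k} (admissible n≥2 k≤ ≢3,1 ≢6,2) with 2 + 2 * k <? n
... | yes <n = inj₁ <n
... | no  ≮n = inj₂ (small k n k≤2 n≥2 k≤ (≮⇒≥ ≮n) ≢3,1 ≢6,2)
  where
  k≤2 : k ≤ 2
  k≤2 = +-cancelʳ-≤ (2 * k) k 2 (≤-trans k≤ (≮⇒≥ ≮n))

  small : ∀ k n → k ≤ 2 → 2 ≤ n → 3 * k ≤ n → n ≤ 2 + 2 * k →
          ¬ (n ≡ 3 × k ≡ 1) → ¬ (n ≡ 6 × k ≡ 2) → (n ≡ 2 × k ≡ 0) ⊎ (n ≡ 4 × k ≡ 1)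
  small 0 n _ n≥2 _ n≤2 _ _ = inj₁ (≤-antisym n≤2 n≥2 , refl)
  small 1 n _ _ n≥3 n≤4 ≢3,1 _ with m≤n⇒m<n∨m≡n n≥3
  ... | inj₁ n≥4  = inj₂ (≤-antisym n≤4 n≥4 , refl)
  ... | inj₂ refl = contradiction (refl , refl) ≢3,1
  small 2 n _ _ n≥6 n≤6 _ ≢6,2 = contradiction (≤-antisym n≤6 n≥6 , refl) ≢6,2
  small (suc (suc (suc k))) n (s≤s (s≤s ())) _ _ _ _ _

-- For ℓ = n - 1 - k this amounts to k < ℓ.
2+2k≤n : ∀ {n k} → Admissible n k → 2 + 2 * k ≤ n
2+2k≤n adm with 2+2k-cases adm
... | inj₁ <n                   = <⇒≤ <n
... | inj₂ (inj₁ (refl , refl)) = ≤-refl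
... | inj₂ (inj₂ (refl , refl)) = ≤-refl

ZeroFree⇒behaving : ∀ {n k} .{{_ : NonZero n}} → Admissible n k → ∀ xs →
                    length xs ≡ n ∸ 1 ∸ k → Cyclic.ZeroFree n xs → Cyclic.Behaving n xs
ZeroFree⇒behaving {n} {k} adm xs |xs| zf with 2+2k-cases adm
-- After adding `2 + 2 * k` to both sides, the goal `n < 2 * length xs` reads
-- `2 + 2 * k + n < 2 * n`.
... | inj₁ <n = Cyclic.long⇒behaving n zf (+-cancelˡ-< (2 + 2 * k) n _ (begin-strict
  2 + 2 * k + n                    <⟨ +-monoˡ-< n <n ⟩
  n + n                            ≡⟨ cong (n +_) (+-identityʳ n) ⟨
  2 * n                            ≡⟨ cong (2 *_) split ⟩
  2 * (1 + k + (n ∸ 1 ∸ k))        ≡⟨ *-distribˡ-+ 2 (1 + k) _ ⟩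
  2 * (1 + k) + 2 * (n ∸ 1 ∸ k)    ≡⟨ cong₂ _+_ (*-distribˡ-+ 2 1 k) (cong (2 *_) (sym |xs|)) ⟩
  2 + 2 * k + 2 * length xs        ∎))
  where
  open ≤-Reasoning
  split : n ≡ 1 + k + (n ∸ 1 ∸ k)
  split = trans (sym (m+[n∸m]≡n (≤-trans (s≤s (≤-trans (m≤m+n k _) (n≤1+n _))) (<⇒≤ <n))))
                (cong (1 + k +_) (sym (∸-+-assoc n 1 k)))
ZeroFree⇒behaving adm (x ∷ [])     |xs| zf | inj₂ (inj₁ (refl , refl)) = singleton-behaving x zf
ZeroFree⇒behaving adm (x ∷ y ∷ []) |xs| zf | inj₂ (inj₂ (refl , refl)) = pair-behaving x y zf

-- Multisets as lists up to permutation.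

multiplicities : ∀ {n} → List (Fin n) → Sequence n
multiplicities []       = Vec.replicate _ 0
multiplicities (x ∷ xs) = updateAt (multiplicities xs) x suc

multiplicities-resp-↭ : ∀ {n} {xs ys : List (Fin n)} → xs ↭ ys → multiplicities xs ≡ multiplicities ys
multiplicities-resp-↭ _↭_.refl          = refl
multiplicities-resp-↭ (prep x p)        = cong (λ S → updateAt S x suc) (multiplicities-resp-↭ p)
multiplicities-resp-↭ (swap {xs} x y p) with x Fin.≟ y
... | yes refl = cong (λ S → updateAt (updateAt S x suc) x suc) (multiplicities-resp-↭ p)
... | no  x≢y  = trans (Vec.updateAt-commutes x y x≢y (multiplicities xs))
                       (cong (λ S → updateAt (updateAt S x suc) y suc) (multiplicities-resp-↭ p))
multiplicities-resp-↭ (_↭_.trans p q)   = trans (multiplicities-resp-↭ p) (multiplicities-resp-↭ q)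

∈⇒0<mult : ∀ {n} {x : Fin n} {xs} → x ∈ xs → 0 < mult x (multiplicities xs)
∈⇒0<mult {xs = x ∷ xs} (here refl) =
  subst (0 <_) (sym (Vec.lookup∘updateAt x (multiplicities xs))) (s≤s z≤n)
∈⇒0<mult {x = x} {y ∷ xs} (there x∈) with x Fin.≟ y
... | yes refl = subst (0 <_) (sym (Vec.lookup∘updateAt x (multiplicities xs))) (s≤s z≤n)
... | no  x≢y  = subst (0 <_) (sym (Vec.lookup∘updateAt′ x y x≢y (multiplicities xs))) (∈⇒0<mult x∈)

0<mult⇒∈ : ∀ {n} {x : Fin n} xs → 0 < mult x (multiplicities xs) → x ∈ xs
0<mult⇒∈ {x = x} []       0<m = contradiction (subst (0 <_) (Vec.lookup-replicate x 0) 0<m) (<-irrefl refl)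
0<mult⇒∈ {x = x} (y ∷ xs) 0<m with x Fin.≟ y
... | yes refl = here refl
... | no  x≢y  = there (0<mult⇒∈ xs (subst (0 <_) (Vec.lookup∘updateAt′ x y x≢y (multiplicities xs)) 0<m))

updateAt-suc-injective : ∀ {n} (x : Fin n) {S T : Sequence n} → updateAt S x suc ≡ updateAt T x suc → S ≡ T
updateAt-suc-injective zero    {s ∷ S} {t ∷ T} refl = refl
updateAt-suc-injective (suc x) {s ∷ S} {t ∷ T} eq   =
  cong₂ _∷_ (Vec.∷-injectiveˡ eq) (updateAt-suc-injective x (Vec.∷-injectiveʳ eq))

-- The head of `xs` has positive multiplicity in `ys`, so it occurs there; removing one copy on both
-- sides allows induction.
multiplicities-reflects-↭ : ∀ {n} (xs ys : List (Fin n)) → multiplicities xs ≡ multiplicities ys → xs ↭ ys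
multiplicities-reflects-↭ []       []       eq = ↭-refl
multiplicities-reflects-↭ []       (y ∷ ys) eq
  with () ← 0<mult⇒∈ {x = y} [] (subst (λ S → 0 < mult y S) (sym eq) (∈⇒0<mult {xs = y ∷ ys} (here refl)))
multiplicities-reflects-↭ (x ∷ xs) ys       eq
  with as , bs , refl ← ∈-∃++ (0<mult⇒∈ ys (subst (λ S → 0 < mult x S) eq (∈⇒0<mult {xs = x ∷ xs} (here refl)))) =
    ↭-trans (prep x (multiplicities-reflects-↭ xs (as ++ bs)
              (updateAt-suc-injective x (trans eq (multiplicities-resp-↭ (shift x as bs))))))
            (↭-sym (shift x as bs))

multiplicities-map-suc : ∀ {n} (xs : List (Fin n)) → multiplicities (map suc xs) ≡ 0 ∷ multiplicities xs
multiplicities-map-suc []       = refl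
multiplicities-map-suc (x ∷ xs) = cong (λ S → updateAt S (suc x) suc) (multiplicities-map-suc xs)

multiplicities-surjective : ∀ {n} (S : Sequence n) → ∃ λ xs → multiplicities xs ≡ S
multiplicities-surjective []      = [] , refl
multiplicities-surjective (s ∷ S) with xs , refl ← multiplicities-surjective S =
  replicate s zero ++ map suc xs , prepend s
  where
  prepend : ∀ s → multiplicities (replicate s zero ++ map suc xs) ≡ s ∷ multiplicities xs
  prepend zero    = multiplicities-map-suc xs
  prepend (suc s) = cong (λ T → updateAt T zero suc) (prepend s)

∣updateAt-suc∣ : ∀ {n} (S : Sequence n) x → ∣ updateAt S x suc ∣ˢ ≡ suc ∣ S ∣ˢ
∣updateAt-suc∣ (s ∷ S) zero    = refl
∣updateAt-suc∣ (s ∷ S) (suc x) = trans (cong (s +_) (∣updateAt-suc∣ S x)) (+-suc s _)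

∣multiplicities∣ : ∀ {n} (xs : List (Fin n)) → ∣ multiplicities xs ∣ˢ ≡ length xs
∣multiplicities∣ {n} [] = zeros n
  where
  zeros : ∀ n → Vec.sum (Vec.replicate n 0) ≡ 0
  zeros zero    = refl
  zeros (suc n) = zeros n
∣multiplicities∣ (x ∷ xs) = trans (∣updateAt-suc∣ (multiplicities xs) x) (cong suc (∣multiplicities∣ xs))

support : ∀ {n} → Sequence n → List (Fin n)
support []          = []
support (zero  ∷ S) = map suc (support S)
support (suc _ ∷ S) = zero ∷ map suc (support S)

support-unique : ∀ {n} (S : Sequence n) → Unique (support S)
support-unique []          = []
support-unique (zero  ∷ S) = Unique.map⁺ Fin.suc-injective (support-unique S)
support-unique (suc _ ∷ S) =
  All.map⁺ (All.tabulate (λ _ ())) ∷ Unique.map⁺ Fin.suc-injective (support-unique S)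

support⁺ : ∀ {n} (S : Sequence n) x → 0 < mult x S → x ∈ support S
support⁺ (suc _ ∷ S) zero    0<m = here refl
support⁺ (zero  ∷ S) (suc x) 0<m = ∈-map⁺ suc (support⁺ S x 0<m)
support⁺ (suc _ ∷ S) (suc x) 0<m = there (∈-map⁺ suc (support⁺ S x 0<m))

support⁻ : ∀ {n} (S : Sequence n) {x} → x ∈ support S → 0 < mult x S
support⁻ (zero  ∷ S) x∈          with _ , x∈′ , refl ← ∈-map⁻ suc x∈ = support⁻ S x∈′
support⁻ (suc _ ∷ S) (here refl) = s≤s z≤n
support⁻ (suc _ ∷ S) (there x∈)  with _ , x∈′ , refl ← ∈-map⁻ suc x∈ = support⁻ S x∈′

updateAt-pred-suc : ∀ {n} (S : Sequence n) x → 0 < mult x S → updateAt (updateAt S x pred) x suc ≡ S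
updateAt-pred-suc (suc s ∷ S) zero    _   = refl
updateAt-pred-suc (s ∷ S)     (suc x) 0<m = cong (s ∷_) (updateAt-pred-suc S x 0<m)

-- Subsums of lists against sums of subsequences.

module _ (n : ℕ) .{{_ : NonZero n}} where

  open Cyclic n
  open RawMonoid (C n) using (_∙_; ε)
  open RawMonoidDefs (C n) using () renaming (sum to sumᶜ)
  open CommutativeMonoid commutativeMonoid using (assoc; commutativeSemigroup)
  open CommutativeSemigroupProperties commutativeSemigroup using (x∙yz≈y∙xz)

  σ-updateAt : ∀ T x → σ n (updateAt T x suc) ≡ x ∙ σ n T
  σ-updateAt T x = go id T x
    where
    -- The induction shortens the vector while the group stays `C n`, so positions are sent to group
    -- elements by an arbitrary `f`.
    go : ∀ {m} (f : Fin m → Fin n) (T : Vec ℕ m) x →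
         sumᶜ (λ a → lookup (updateAt T x suc) a · f a) ≡ f x ∙ sumᶜ (λ a → lookup T a · f a)
    go f (t ∷ T) zero    = assoc (f zero) _ _
    go f (t ∷ T) (suc x) = trans (cong (t · f zero ∙_) (go (f ∘ suc) T x)) (x∙yz≈y∙xz (t · f zero) _ _)

  σ-zeros : σ n (Vec.replicate n 0) ≡ ε
  σ-zeros = go id
    where
    go : ∀ {m} (f : Fin m → Fin n) → sumᶜ (λ a → lookup (Vec.replicate m 0) a · f a) ≡ ε
    go {zero}  f = refl
    go {suc m} f = trans (∙-identityˡ _) (go (f ∘ suc))

  ⊑-∷⁺ : ∀ {T : Sequence n} (y : Fin n) ys → T ⊑ multiplicities ys → T ⊑ multiplicities (y ∷ ys)
  ⊑-∷⁺ y ys T⊑ a with a Fin.≟ y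
  ... | yes refl = ≤-trans (m≤n⇒m≤1+n (T⊑ a)) (≤-reflexive (sym (Vec.lookup∘updateAt a (multiplicities ys))))
  ... | no  a≢y  = ≤-trans (T⊑ a) (≤-reflexive (sym (Vec.lookup∘updateAt′ a y a≢y (multiplicities ys))))

  ⊑-updateAt : ∀ {S T : Sequence n} y → S ⊑ T → updateAt S y suc ⊑ updateAt T y suc
  ⊑-updateAt {S} {T} y S⊑T a with a Fin.≟ y
  ... | yes refl rewrite Vec.lookup∘updateAt a {suc} S | Vec.lookup∘updateAt a {suc} T = s≤s (S⊑T a)
  ... | no  a≢y rewrite Vec.lookup∘updateAt′ a y {suc} a≢y S | Vec.lookup∘updateAt′ a y {suc} a≢y T = S⊑T a

  ∈Σ⇒⊑ : ∀ {x xs} → x ∈Σ xs → ∃ λ T → T ⊑ multiplicities xs × σ n T ≡ x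
  ∈Σ⇒⊑ none = Vec.replicate n 0 , (λ _ → ≤-refl) , σ-zeros
  ∈Σ⇒⊑ (skip {y = y} {ys} x∈) with T , T⊑ , refl ← ∈Σ⇒⊑ x∈ = T , ⊑-∷⁺ {T} y ys T⊑ , refl
  ∈Σ⇒⊑ (pick {y = y} {ys} x∈) with T , T⊑ , refl ← ∈Σ⇒⊑ x∈ =
    updateAt T y suc , ⊑-updateAt {T} {multiplicities ys} y T⊑ , σ-updateAt T y

  -- The counterpart of `skip` and `pick`: either `ys` has enough copies of `y` for `T`, or `T`
  -- needs the extra one, which can be taken off.
  ⊑-∷⁻ : ∀ {T : Sequence n} (y : Fin n) ys → T ⊑ multiplicities (y ∷ ys) →
         T ⊑ multiplicities ys ⊎ ∃ λ T′ → T′ ⊑ multiplicities ys × updateAt T′ y suc ≡ T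
  ⊑-∷⁻ {T} y ys T⊑ with mult y T ≤? mult y (multiplicities ys)
  ... | yes ≤y = inj₁ T⊑′
    where
    T⊑′ : T ⊑ multiplicities ys
    T⊑′ a with a Fin.≟ y
    ... | yes refl = ≤y
    ... | no  a≢y  = ≤-trans (T⊑ a) (≤-reflexive (Vec.lookup∘updateAt′ a y a≢y (multiplicities ys)))
  ... | no ≰y = inj₂ (updateAt T y pred , T⊑′ , updateAt-pred-suc T y (≤-<-trans z≤n (≰⇒> ≰y)))
    where
    T⊑′ : updateAt T y pred ⊑ multiplicities ys
    T⊑′ a with a Fin.≟ y
    ... | yes refl rewrite Vec.lookup∘updateAt a {pred} T =
      ≤-trans (pred-mono-≤ (T⊑ a)) (≤-reflexive (cong pred (Vec.lookup∘updateAt a (multiplicities ys))))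
    ... | no  a≢y rewrite Vec.lookup∘updateAt′ a y {pred} a≢y T =
      ≤-trans (T⊑ a) (≤-reflexive (Vec.lookup∘updateAt′ a y a≢y (multiplicities ys)))

  ⊑⇒∈Σ : ∀ (xs : List (Fin n)) {T} → T ⊑ multiplicities xs → σ n T ∈Σ xs
  ⊑⇒∈Σ [] {T} T⊑ = subst (_∈Σ []) (sym (trans (cong (σ n) T≡0) σ-zeros)) none
    where
    T≡0 : T ≡ Vec.replicate n 0
    T≡0 = trans (sym (Vec.tabulate∘lookup T))
      (trans (Vec.tabulate-cong zero-at) (Vec.tabulate∘lookup (Vec.replicate n 0)))
      where
      zero-at : ∀ a → lookup T a ≡ lookup (Vec.replicate n 0) a
      zero-at a = trans (n≤0⇒n≡0 (subst (lookup T a ≤_) (Vec.lookup-replicate a 0) (T⊑ a)))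
                        (sym (Vec.lookup-replicate a 0))
  ⊑⇒∈Σ (y ∷ ys) {T} T⊑ with ⊑-∷⁻ {T} y ys T⊑
  ... | inj₁ T⊑ys = skip (⊑⇒∈Σ ys {T} T⊑ys)
  ... | inj₂ (T′ , T′⊑ , refl) = subst (_∈Σ y ∷ ys) (sym (σ-updateAt T′ y)) (pick (⊑⇒∈Σ ys {T′} T′⊑))

  ZeroFree⇒ZeroSumFree : ∀ {xs} → ZeroFree xs → ZeroSumFree n (multiplicities xs)
  ZeroFree⇒ZeroSumFree {[]} [] (T , T⊑ , 0<T , _) =
    <⇒≱ 0<T (≤-trans (sum-mono T (Vec.replicate n 0) T⊑) (≤-reflexive (∣multiplicities∣ {n} [])))
    where
    sum-mono : ∀ {m} (S T : Vec ℕ m) → (∀ a → lookup S a ≤ lookup T a) → Vec.sum S ≤ Vec.sum T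
    sum-mono []      []      _  = z≤n
    sum-mono (s ∷ S) (t ∷ T) le = +-mono-≤ (le zero) (sum-mono S T (le ∘ suc))
  ZeroFree⇒ZeroSumFree {y ∷ ys} (y+ ∷ zf) (T , T⊑ , 0<T , σT≡ε) with ⊑-∷⁻ {T} y ys T⊑
  ... | inj₁ T⊑ys = ZeroFree⇒ZeroSumFree zf (T , T⊑ys , 0<T , σT≡ε)
  ... | inj₂ (T′ , T′⊑ , refl) = y+ (⊑⇒∈Σ ys {T′} T′⊑) (trans (sym (σ-updateAt T′ y)) σT≡ε)

  ZeroSumFree⇒ZeroFree : ∀ xs → ZeroSumFree n (multiplicities xs) → ZeroFree xs
  ZeroSumFree⇒ZeroFree []       _   = []
  ZeroSumFree⇒ZeroFree (y ∷ ys) zsf =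
    y+ ∷ ZeroSumFree⇒ZeroFree ys λ (T , T⊑ , rest) → zsf (T , ⊑-∷⁺ {T} y ys T⊑ , rest)
    where
    y+ : ∀ {x} → x ∈Σ ys → y ∙ x ≢ ε
    y+ x∈ eq with T , T⊑ , refl ← ∈Σ⇒⊑ x∈ =
      zsf (updateAt T y suc , ⊑-updateAt {T} {multiplicities ys} y T⊑
          , subst (0 <_) (sym (∣updateAt-suc∣ T y)) (s≤s z≤n) , trans (σ-updateAt T y) eq)

Unique-map⁺ : ∀ {A B : Set} {f : A → B} {xs} →
              (∀ {x y} → x ∈ xs → y ∈ xs → f x ≡ f y → x ≡ y) → Unique xs → Unique (map f xs)
Unique-map⁺ inj [] = []
Unique-map⁺ {f = f} inj (x≢ ∷ xs!) =
  All.map⁺ (All.tabulate λ y∈ eq → All.lookup x≢ y∈ (inj (here refl) (there y∈) eq))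
  ∷ Unique-map⁺ (λ x∈ y∈ → inj (there x∈) (there y∈)) xs!

-- Partitions as coefficient lists.

sorted-↭⇒≡ : ∀ {xs ys} → Linked _≤_ xs → Linked _≤_ ys → xs ↭ ys → xs ≡ ys
sorted-↭⇒≡ xs↗ ys↗ p = Pointwise-≡⇒≡ (↗↭↗⇒≋ ≤-totalOrder xs↗ ys↗ (↭⇒↭ₛ′ isEquivalence p))

-- The coefficients `jᵢ` whose nonzero `jᵢ - 1` are `λs`, with `c` of them equal to 1.
raise : ℕ → List ℕ → List ℕ
raise c λs = map suc λs ++ replicate c 1

length-raise : ∀ c λs → length (raise c λs) ≡ length λs + c
length-raise c λs = trans (length-++ (map suc λs)) (cong₂ _+_ (length-map suc λs) (length-replicate c))

sum-raise : ∀ c λs → sum (raise c λs) ≡ length λs + c + sum λs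
sum-raise zero    []       = refl
sum-raise (suc c) []       = cong suc (sum-raise c [])
sum-raise c       (x ∷ λs) = cong suc (trans (cong (x +_) (sum-raise c λs)) (x∙yz≈y∙xz x (length λs + c) (sum λs)))
  where open import Algebra.Properties.CommutativeSemigroup +-commutativeSemigroup using (x∙yz≈y∙xz)

raise-positive : ∀ c λs → All (0 <_) (raise c λs)
raise-positive c λs = All.++⁺ (All.map⁺ (All.universal (λ _ → s≤s z≤n) λs)) (All.replicate⁺ c (s≤s z≤n))

map-pred-raise : ∀ c λs → map pred (raise c λs) ≡ λs ++ replicate c 0
map-pred-raise c λs = trans (map-++ pred (map suc λs) _)
  (cong₂ _++_ (trans (sym (map-∘ λs)) (map-id λs)) (map-replicate pred c 1))

lower : List ℕ → List ℕ
lower js = filter (0 <?_) (map pred js)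

lower-raise : ∀ c {λs} → All (0 <_) λs → lower (raise c λs) ≡ λs
lower-raise c {λs} 0<λs = begin
  filter (0 <?_) (map pred (raise c λs))                      ≡⟨ cong (filter (0 <?_)) (map-pred-raise c λs) ⟩
  filter (0 <?_) (λs ++ replicate c 0)                        ≡⟨ filter-++ (0 <?_) λs _ ⟩
  filter (0 <?_) λs ++ filter (0 <?_) (replicate c 0)         ≡⟨ cong₂ _++_ (filter-all (0 <?_) 0<λs)
                                                                            (filter-none (0 <?_) (All.replicate⁺ c (<-irrefl refl))) ⟩
  λs ++ []                                                    ≡⟨ ++-identityʳ λs ⟩
  λs                                                          ∎
  where open ≡-Reasoning

raise-lower : ∀ {js} → All (0 <_) js → ∃₂ λ c λs → js ↭ raise c λs × All (0 <_) λs
raise-lower [] = 0 , [] , ↭-refl , []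
raise-lower {suc j ∷ js} (_ ∷ 0<js) with c , λs , p , 0<λs ← raise-lower 0<js | j
... | zero   = suc c , λs , ↭-trans (prep 1 p) (↭-sym (shift 1 (map suc λs) _)) , 0<λs
... | suc j′ = c , suc j′ ∷ λs , prep _ p , s≤s z≤n ∷ 0<λs

sum-pred-raise : ∀ c λs → sum (map pred (raise c λs)) ≡ sum λs
sum-pred-raise c λs = trans (cong sum (map-pred-raise c λs))
  (trans (sum-++ λs _) (trans (cong (sum λs +_) (trans (sum-replicate c 0) (*-zeroʳ c))) (+-identityʳ _)))

PartitionUpTo : ℕ → List ℕ → Set
PartitionUpTo k λs = All (0 <_) λs × Linked _≤_ λs × sum λs ≤ k

-- The bijection from pairs of a generator and a partition to zero-sum free sequences.

module Encoding (n k ℓ : ℕ) .{{_ : NonZero n}} (adm : Admissible n k)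
                (n≡ : n ≡ suc (k + ℓ)) (k<ℓ : k < ℓ) where

  open Cyclic n
  open RawMonoid (C n) using (ε)
  open Admissible adm

  coefficientsOf : List ℕ → List ℕ
  coefficientsOf λs = raise (ℓ ∸ length λs) λs

  encode : Fin n → List ℕ → Sequence n
  encode g λs = multiplicities (map (_· g) (coefficientsOf λs))

  module _ {λs} (part : PartitionUpTo k λs) where

    length≤k : length λs ≤ k
    length≤k = let 0<λs , _ , ≤k = part in ≤-trans (length≤sum 0<λs) ≤k

    length-coefficients : length (coefficientsOf λs) ≡ ℓ
    length-coefficients = trans (length-raise _ λs) (m+[n∸m]≡n (≤-trans length≤k (<⇒≤ k<ℓ)))

    sum-coefficients : sum (coefficientsOf λs) < n
    sum-coefficients = let _ , _ , ≤k = part in begin-strict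
      sum (coefficientsOf λs)                        ≡⟨ sum-raise (ℓ ∸ length λs) λs ⟩
      length λs + (ℓ ∸ length λs) + sum λs           ≡⟨ cong (_+ sum λs) (m+[n∸m]≡n (≤-trans length≤k (<⇒≤ k<ℓ))) ⟩
      ℓ + sum λs                                     ≤⟨ +-monoʳ-≤ ℓ ≤k ⟩
      ℓ + k                                          <⟨ n<1+n _ ⟩
      suc (ℓ + k)                                    ≡⟨ trans n≡ (cong suc (+-comm k ℓ)) ⟨
      n                                              ∎
      where open ≤-Reasoning

    coefficients< : All (_< n) (coefficientsOf λs)
    coefficients< = All.map (λ ≤s → ≤-<-trans ≤s sum-coefficients) (parts≤sum (coefficientsOf λs))

    0<ones : 0 < ℓ ∸ length λs
    0<ones = m<n⇒0<n∸m (≤-<-trans length≤k k<ℓ)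

    ∣encode∣ : ∀ g → ∣ encode g λs ∣ˢ ≡ ℓ
    ∣encode∣ g = trans (∣multiplicities∣ (map (_· g) (coefficientsOf λs)))
      (trans (length-map _ (coefficientsOf λs)) length-coefficients)

    encode-ZeroSumFree : ∀ {g} → IsGenerator n g → ZeroSumFree n (encode g λs)
    encode-ZeroSumFree gen = ZeroFree⇒ZeroSumFree n
      (behaving⇒ZeroFree (coefficientsOf λs) gen (raise-positive _ λs) sum-coefficients)

    -- A part `x` yields the element `suc x · g`, different from `1 · g` because parts are positive.
    -- The coefficient 1 occurs since `length λs ≤ k < ℓ`. All coefficients are below `n`, so
    -- distinct ones give distinct elements.
    length-support-encode : ∀ {g} → IsGenerator n g → length (support (encode g λs)) ≡ suc (distinctParts λs)
    length-support-encode {g} gen = trans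
      (≤-antisym (Unique-⊆⇒length≤ (support-unique (encode g λs)) ⊆₁) (Unique-⊆⇒length≤ vals! ⊆₂))
      (cong suc (length-map _ (deduplicate _≟_ λs)))
      where
      vals : List (Fin n)
      vals = 1 · g ∷ map (λ x → suc x · g) (deduplicate _≟_ λs)

      suc∈ : ∀ {x} → x ∈ λs → suc x ∈ coefficientsOf λs
      suc∈ x∈ = ∈-++⁺ˡ (∈-map⁺ suc x∈)

      1∈ : 1 ∈ coefficientsOf λs
      1∈ = ∈-++⁺ʳ (map suc λs) (ones 0<ones)
        where
        ones : ∀ {c} → 0 < c → 1 ∈ replicate c 1
        ones {suc c} _ = here refl

      inj : ∀ {i j} → i ∈ coefficientsOf λs → j ∈ coefficientsOf λs → i · g ≡ j · g → i ≡ j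
      inj i∈ j∈ = ·-injective gen (All.lookup coefficients< i∈) (All.lookup coefficients< j∈)

      vals! : Unique vals
      vals! = All.map⁺ (All.tabulate (λ {x} x∈ eq →
                let x∈λs = ∈-deduplicate⁻ _≟_ λs x∈ in
                <-irrefl (suc-injective (inj 1∈ (suc∈ x∈λs) eq)) (All.lookup (proj₁ part) x∈λs)))
            ∷ Unique-map⁺ (λ x∈ y∈ eq → suc-injective
                            (inj (suc∈ (∈-deduplicate⁻ _≟_ λs x∈)) (suc∈ (∈-deduplicate⁻ _≟_ λs y∈)) eq))
                          (deduplicate-! _≟_ λs)

      ⊆₁ : support (encode g λs) ⊆ vals
      ⊆₁ {a} a∈
        with j , j∈ , refl ← ∈-map⁻ (_· g)
               (0<mult⇒∈ {x = a} (map (_· g) (coefficientsOf λs)) (support⁻ (encode g λs) a∈))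
        with ∈-++⁻ (map suc λs) j∈
      ... | inj₁ j∈sucs with x , x∈ , refl ← ∈-map⁻ suc j∈sucs = there (∈-map⁺ _ (∈-deduplicate⁺ _≟_ x∈))
      ... | inj₂ j∈ones with refl ← All.lookup (All.replicate⁺ {P = _≡ 1} (ℓ ∸ length λs) refl) j∈ones = here refl

      ⊆₂ : vals ⊆ support (encode g λs)
      ⊆₂ (here refl) = support⁺ (encode g λs) _ (∈⇒0<mult (∈-map⁺ (_· g) 1∈))
      ⊆₂ (there a∈) with x , x∈ , refl ← ∈-map⁻ _ a∈ =
        support⁺ (encode g λs) _ (∈⇒0<mult (∈-map⁺ (_· g) (suc∈ (∈-deduplicate⁻ _≟_ λs x∈))))

  -- The coefficients `js` of the behaving sequence split into ones and raised parts, which are then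
  -- sorted. The parts sum to at most `k` because `ℓ` plus their sum is `sum js < n`, and `n` is
  -- `suc (ℓ + k)`.
  encode-surjective : ∀ S → ∣ S ∣ˢ ≡ ℓ → ZeroSumFree n S →
                      ∃₂ λ g λs → IsGenerator n g × PartitionUpTo k λs × encode g λs ≡ S
  encode-surjective S |S| zsf
    with xs , refl ← multiplicities-surjective S
    with |xs| ← trans (sym (∣multiplicities∣ xs)) |S|
    with g , js , gen , p , 0<js , <n ← ZeroFree⇒behaving adm xs
           (trans |xs| (sym (trans (cong (λ m → m ∸ 1 ∸ k) n≡) (m+n∸m≡n k ℓ)))) (ZeroSumFree⇒ZeroFree n xs zsf)
    with c , μ , q , 0<μ ← raise-lower 0<js
    = g , sort μ , gen , (All-resp-↭ (↭-sym (sort-↭ μ)) 0<μ , sort-↗ μ , sum≤k)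
      , multiplicities-resp-↭ (↭-trans
          (map⁺ (_· g) (↭-trans (↭-reflexive (cong (λ d → raise d (sort μ)) (sym c≡))) (↭-sym r))) (↭-sym p))
    where
    r : js ↭ raise c (sort μ)
    r = ↭-trans q (++⁺ʳ (replicate c 1) (map⁺ suc (↭-sym (sort-↭ μ))))

    total-length : length (sort μ) + c ≡ ℓ
    total-length = trans (sym (length-raise c (sort μ))) (trans (sym (↭-length r))
      (trans (sym (length-map (_· g) js)) (trans (sym (↭-length p)) |xs|)))

    c≡ : c ≡ ℓ ∸ length (sort μ)
    c≡ = trans (sym (m+n∸m≡n (length (sort μ)) c)) (cong (_∸ length (sort μ)) total-length)

    sum≤k : sum (sort μ) ≤ k
    sum≤k = +-cancelˡ-≤ (suc ℓ) _ _ (begin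
      suc ℓ + sum (sort μ)                      ≡⟨ cong (λ m → suc m + sum (sort μ)) total-length ⟨
      suc (length (sort μ) + c + sum (sort μ))  ≡⟨ cong suc (sum-raise c (sort μ)) ⟨
      suc (sum (raise c (sort μ)))              ≡⟨ cong suc (sum-↭ r) ⟨
      suc (sum js)                              ≤⟨ <n ⟩
      n                                         ≡⟨ trans n≡ (cong suc (+-comm k ℓ)) ⟩
      suc ℓ + k                                 ∎)
      where open ≤-Reasoning

  module _ {g} (gen : IsGenerator n g) where

    -- The discrete logarithm to base `g`. The multiplier supplied by `gen` is arbitrary, so it is
    -- reduced modulo `n`.
    log : Fin n → ℕ
    log a = toℕ (proj₁ (gen a) mod n)

    log·g : ∀ a → log a · g ≡ a
    log·g a = trans (·-mod n (proj₁ (gen a)) g) (proj₂ (gen a))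

    log-· : ∀ {j} → j < n → log (j · g) ≡ j
    log-· j<n = ·-injective gen (Fin.toℕ<n _) j<n (log·g _)

    map-log-· : ∀ {js} → All (_< n) js → map log (map (_· g) js) ≡ js
    map-log-· {js} <n = trans (sym (map-∘ js)) (map-id-local (All.map log-· <n))

  1·_ : ∀ a → 1 · a ≡ a
  1· a = trans (∙-comm a ε) (∙-identityˡ a)

  encode⇒↭ : ∀ {g g′} λs μ → encode g λs ≡ encode g′ μ →
             map (_· g) (coefficientsOf λs) ↭ map (_· g′) (coefficientsOf μ)
  encode⇒↭ λs μ eq = multiplicities-reflects-↭ _ _ eq

  -- If g′ = m g, each of the at least ℓ - k copies of g′ contributes m - 1 to sum λs.
  copies*pred-log≤k : ∀ {g g′ λs μ} (gen : IsGenerator n g) → PartitionUpTo k λs → PartitionUpTo k μ →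
                      encode g λs ≡ encode g′ μ → (ℓ ∸ k) * pred (log gen g′) ≤ k
  copies*pred-log≤k {g} {g′} {λs} {μ} gen part partμ eq = begin
    (ℓ ∸ k) * pred (log gen g′)                       ≤⟨ *-monoˡ-≤ (pred (log gen g′)) (∸-monoʳ-≤ ℓ (length≤k partμ)) ⟩
    c * pred (log gen g′)                             ≡⟨ cong (λ a → c * pred (log gen a)) (1· g′) ⟨
    c * f 1                                           ≡⟨ sum-replicate c (f 1) ⟨
    sum (replicate c (f 1))                           ≤⟨ m≤n+m _ _ ⟩
    sum (map f (map suc μ)) + sum (replicate c (f 1)) ≡⟨ sum-++ (map f (map suc μ)) _ ⟨
    sum (map f (map suc μ) ++ replicate c (f 1))      ≡⟨ cong (λ xs → sum (map f (map suc μ) ++ xs)) (map-replicate f c 1) ⟨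
    sum (map f (map suc μ) ++ map f (replicate c 1))  ≡⟨ cong sum (map-++ f (map suc μ) _) ⟨
    sum (map f (coefficientsOf μ))                    ≡⟨ cong sum (trans (map-∘ (coefficientsOf μ))
                                                                    (cong (map pred) (map-∘ (coefficientsOf μ)))) ⟩
    sum (map pred (map (log gen) (map (_· g′) (coefficientsOf μ))))
                                                      ≡⟨ sum-↭ (map⁺ pred (map⁺ (log gen) (encode⇒↭ λs μ eq))) ⟨
    sum (map pred (map (log gen) (map (_· g) (coefficientsOf λs))))
                                                      ≡⟨ cong (λ js → sum (map pred js)) (map-log-· gen (coefficients< part)) ⟩
    sum (map pred (coefficientsOf λs))                ≡⟨ sum-pred-raise (ℓ ∸ length λs) λs ⟩
    sum λs                                            ≤⟨ proj₂ (proj₂ part) ⟩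
    k                                                 ∎
    where
    open ≤-Reasoning
    c = ℓ ∸ length μ
    f : ℕ → ℕ
    f j = pred (log gen (j · g′))

  -- Compare `3 * k ≤ n` with n = 2k + (ℓ - k) + 1.
  k≤1+w : k ≤ suc (ℓ ∸ k)
  k≤1+w = +-cancelˡ-≤ (k + k) k _ (begin
    k + k + k                  ≡⟨ trans (cong (λ x → k + (k + x)) (+-identityʳ k)) (sym (+-assoc k k k)) ⟨
    3 * k                      ≤⟨ k≤ ⟩
    n                          ≡⟨ n≡ ⟩
    suc (k + ℓ)                ≡⟨ cong (λ x → suc (k + x)) (m+[n∸m]≡n (<⇒≤ k<ℓ)) ⟨
    suc (k + (k + (ℓ ∸ k)))    ≡⟨ cong suc (+-assoc k k _) ⟨
    suc (k + k + (ℓ ∸ k))      ≡⟨ +-suc (k + k) _ ⟨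
    k + k + suc (ℓ ∸ k)        ∎)
    where open ≤-Reasoning

  -- With w = ℓ - k ≥ 1, the chain 2w ≤ k ≤ w + 1 forces w = 1 and k = 2. Then ℓ = 3 and n = 6, an
  -- excluded pair.
  copies*2≰k : ¬ ((ℓ ∸ k) * 2 ≤ k)
  copies*2≰k le = ≢6,2 (trans n≡ (cong suc (cong₂ _+_ k≡2 ℓ≡3)) , k≡2)
    where
    w = ℓ ∸ k
    w≡1 : w ≡ 1
    w≡1 = ≤-antisym (+-cancelˡ-≤ w w 1 (begin
        w + w     ≡⟨ trans (*-comm w 2) (cong (w +_) (+-identityʳ w)) ⟨
        w * 2     ≤⟨ ≤-trans le k≤1+w ⟩
        suc w     ≡⟨ +-comm w 1 ⟨
        w + 1     ∎)) (m<n⇒0<n∸m k<ℓ)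
      where open ≤-Reasoning
    k≡2 : k ≡ 2
    k≡2 = ≤-antisym (subst (λ v → k ≤ suc v) w≡1 k≤1+w) (subst (λ v → v * 2 ≤ k) w≡1 le)
    ℓ≡3 : ℓ ≡ 3
    ℓ≡3 = trans (sym (m+[n∸m]≡n (<⇒≤ k<ℓ))) (cong₂ _+_ k≡2 w≡1)

  -- Cases on the logarithm m of `g′`: m = 0 makes `g′` zero, and m ≥ 3 makes `copies*pred-log≤k`
  -- contradict `copies*2≰k`. For m = 2 the inequality is passed on to `generator-unique`.
  same-or-double : ∀ {g g′ λs μ} → IsGenerator n g → IsGenerator n g′ →
                     PartitionUpTo k λs → PartitionUpTo k μ →
                   encode g λs ≡ encode g′ μ → g ≡ g′ ⊎ (2 · g ≡ g′ × ℓ ∸ k ≤ k)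
  same-or-double {g} {g′} gen gen′ part partμ eq
    with log gen g′ | log·g gen g′ | copies*pred-log≤k gen part partμ eq
  ... | 0 | refl | _  = contradiction (generator-order {o = 1} gen′ (s≤s z≤n) (·-ε 1)) (<⇒≱ n≥2)
  ... | 1 | refl | _  = inj₁ (sym (1· g))
  ... | 2 | refl | le = inj₂ (refl , subst (_≤ k) (*-identityʳ _) le)
  ... | suc (suc (suc m)) | _ | le =
    contradiction (≤-trans (*-monoʳ-≤ (ℓ ∸ k) (s≤s (s≤s z≤n))) le) copies*2≰k

  -- If each generator is the double of the other, then 3 g = 0, so `n ≤ 3` and `k ≤ 1`. Here
  -- `k ≡ 1` would mean `n ≡ 3`, which is excluded, and `k ≡ 0` contradicts `0 < ℓ ∸ k ≤ k`.
  generator-unique : ∀ {g g′ λs μ} → IsGenerator n g → IsGenerator n g′ →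
                     PartitionUpTo k λs → PartitionUpTo k μ →
                     encode g λs ≡ encode g′ μ → g ≡ g′
  generator-unique {g} gen gen′ part partμ eq
    with same-or-double gen gen′ part partμ eq | same-or-double gen′ gen partμ part (sym eq)
  ... | inj₁ g≡g′         | _          = g≡g′
  ... | inj₂ _            | inj₁ g′≡g  = sym g′≡g
  ... | inj₂ (refl , w≤k) | inj₂ (4g≡g , _) = contradiction w≤k (<⇒≱ k<w)
    where
    n≤3 : n ≤ 3
    n≤3 = generator-order {o = 3} gen (s≤s z≤n)
      (·-cancel {i = 1} {j = 4} (s≤s z≤n) (trans (1· g) (trans (sym 4g≡g) (×-assocˡ g 2 2))))

    k≡0 : k ≡ 0
    k≡0 = n≤0⇒n≡0 (≤-pred (≤∧≢⇒< k≤1 λ k≡1 → ≢3,1 (≤-antisym n≤3 (subst (λ x → 3 * x ≤ n) k≡1 k≤) , k≡1)))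
      where
      k≤1 : k ≤ 1
      k≤1 = *-cancelˡ-≤ 3 (≤-trans k≤ n≤3)

    k<w : k < ℓ ∸ k
    k<w = ≤-<-trans (≤-reflexive k≡0) (m<n⇒0<n∸m k<ℓ)

  -- Once the generators agree, logarithms recover the coefficients up to order. Subtracting 1 and
  -- dropping zeros recovers the parts, and sortedness fixes their order.
  encode-injective : ∀ {g g′ λs μ} → IsGenerator n g → IsGenerator n g′ →
                     PartitionUpTo k λs → PartitionUpTo k μ →
                     encode g λs ≡ encode g′ μ → g ≡ g′ × λs ≡ μ
  encode-injective {g} {g′} {λs} {μ} gen gen′ part@(0<λs , λs↗ , _) partμ@(0<μ , μ↗ , _) eq
    with refl ← generator-unique gen gen′ part partμ eq =
      refl , sorted-↭⇒≡ λs↗ μ↗ (↭-trans (↭-reflexive (sym (lower-raise _ 0<λs)))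
        (↭-trans (filter-↭ (0 <?_) (map⁺ pred coefficients↭)) (↭-reflexive (lower-raise _ 0<μ))))
    where
    coefficients↭ : coefficientsOf λs ↭ coefficientsOf μ
    coefficients↭ = ↭-trans (↭-reflexive (sym (map-log-· gen (coefficients< part))))
      (↭-trans (map⁺ (log gen) (encode⇒↭ λs μ eq)) (↭-reflexive (map-log-· gen (coefficients< partμ))))

-- Listing the partitions counted by the formula.

concatMap-unique : ∀ {A B : Set} {f : A → List B} (tag : B → A) {xs} →
                   (∀ {x z} → x ∈ xs → z ∈ f x → tag z ≡ x) → (∀ x → Unique (f x)) →
                   Unique xs → Unique (concatMap f xs)
concatMap-unique tag tag≡ f! [] = []
concatMap-unique {f = f} tag {x ∷ xs} tag≡ f! (x≢ ∷ xs!) =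
  -- `tag` recovers the block an entry comes from, so an entry common to two blocks would identify
  -- `x` with a later `y`.
  Unique.++⁺ (f! x) (concatMap-unique tag (tag≡ ∘ there) f! xs!) λ (z∈x , z∈xs) →
    let y , y∈ , z∈y = find (∈-concatMap⁻ f {xs = xs} z∈xs)
    in All.lookup x≢ y∈ (trans (sym (tag≡ (here refl) z∈x)) (tag≡ (there y∈) z∈y))

∈-range⁺ : ∀ {a b x} → a ≤ x → x ≤ b → x ∈ range a b
∈-range⁺ {a} {b} {x} a≤x x≤b =
  subst (_∈ range a b) (m+[n∸m]≡n a≤x) (∈-map⁺ (a +_) (∈-upTo⁺ (∸-monoˡ-< (s≤s x≤b) a≤x)))

∈-range⁻ : ∀ a b {x} → x ∈ range a b → a ≤ x × x ≤ b
∈-range⁻ a b {x} x∈ with i , i∈ , refl ← ∈-map⁻ (a +_) x∈ =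
  m≤m+n a i , ≤-pred (≤-trans (≤-reflexive (sym (+-suc a i)))
    (≤-trans (+-monoʳ-≤ a (∈-upTo⁻ i∈)) (≤-reflexive (m+[n∸m]≡n a≤1+b))))
  where
  -- Otherwise `suc b ∸ a` truncates to 0 and the range is empty.
  a≤1+b : a ≤ suc b
  a≤1+b = <⇒≤ (m∸n≢0⇒n<m (λ eq → n≮0 (subst (i <_) eq (∈-upTo⁻ i∈))))

range-unique : ∀ a b → Unique (range a b)
range-unique a b = Unique.map⁺ (+-cancelˡ-≡ a _ _) (Unique.upTo⁺ (suc b ∸ a))

-- Pigeonhole: `suc m` distinct positive numbers do not fit into `1 … m`.
exists-≥length : ∀ {m xs} → length xs ≡ suc m → Unique xs → ∃ λ x → x ∈ xs × (All (0 <_) xs → suc m ≤ x)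
exists-≥length {m} {xs} |xs| xs! with any? (suc m ≤?_) xs
... | yes any = let x , x∈ , ≤x = find any in x , x∈ , λ _ → ≤x
exists-≥length {m} {x ∷ xs} |xs| xs! | no ¬any = x , here refl , λ 0<xs →
  contradiction
    (≤-trans (≤-reflexive (sym |xs|))
    (≤-trans (Unique-⊆⇒length≤ xs! (λ y∈ → small (All.lookup 0<xs y∈) y∈))
    (≤-reflexive (trans (length-map suc (upTo m)) (length-upTo m))))) 1+n≰n
  where
  small : ∀ {y} → 0 < y → y ∈ x ∷ xs → y ∈ map suc (upTo m)
  small {suc y} _ y∈ = ∈-map⁺ suc (∈-upTo⁺ (≤-pred (≰⇒> (λ ≤y → ¬any (lose y∈ ≤y)))))

-- Remove an entry at least as large as the length of the list, and apply induction to the rest.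
triangular≤sum : ∀ m {xs} → length xs ≡ m → Unique xs → All (0 <_) xs → m * suc m ≤ 2 * sum xs
triangular≤sum zero    |xs| xs! 0<xs = z≤n
triangular≤sum (suc m) {xs} |xs| xs! 0<xs
  with x , x∈ , big ← exists-≥length |xs| xs!
  with as , bs , refl ← ∈-∃++ x∈
  with p ← shift x as bs
  with _ ∷ rest! ← Permutationₛ.AllPairs-resp-↭ (setoid ℕ) ≢-sym
         ((λ { refl x≢ → x≢ }) , (λ { refl x≢ → x≢ })) (↭⇒↭ₛ p) xs!
  with _ ∷ 0<rest ← All-resp-↭ p 0<xs = begin
    suc m * suc (suc m)               ≡⟨ rearrange m ⟩
    2 * suc m + m * suc m             ≤⟨ +-mono-≤ (*-monoʳ-≤ 2 (big 0<xs)) (triangular≤sum m |rest| rest! 0<rest) ⟩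
    2 * x + 2 * sum (as ++ bs)        ≡⟨ *-distribˡ-+ 2 x _ ⟨
    2 * (x + sum (as ++ bs))          ≡⟨ cong (2 *_) (sum-↭ p) ⟨
    2 * sum (as ++ x ∷ bs)            ∎
  where
  open ≤-Reasoning
  rearrange : ∀ m → suc m * suc (suc m) ≡ 2 * suc m + m * suc m
  rearrange = solve-∀
  |rest| : length (as ++ bs) ≡ m
  |rest| = suc-injective (trans (sym (↭-length p)) |xs|)

sum-filter≤ : ∀ {P : ℕ → Set} (P? : Decidable P) xs → sum (filter P? xs) ≤ sum xs
sum-filter≤ P? []       = z≤n
sum-filter≤ P? (x ∷ xs) with P? x
... | yes _ = +-monoʳ-≤ x (sum-filter≤ P? xs)
... | no  _ = ≤-trans (sum-filter≤ P? xs) (m≤n+m _ x)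

sum-deduplicate≤ : ∀ xs → sum (deduplicate _≟_ xs) ≤ sum xs
sum-deduplicate≤ []       = z≤n
sum-deduplicate≤ (x ∷ xs) =
  +-monoʳ-≤ x (≤-trans (sum-filter≤ (¬? ∘ (x ≟_)) (deduplicate _≟_ xs)) (sum-deduplicate≤ xs))

-- This is why neither the cut-off `D k` nor the lower limit `(d ∸ 1) * d / 2` loses a partition.
distinctParts-bound : ∀ {λs} → All (0 <_) λs → distinctParts λs * suc (distinctParts λs) ≤ 2 * sum λs
distinctParts-bound {λs} 0<λs = ≤-trans
  (triangular≤sum _ refl (deduplicate-! _≟_ λs) (All.tabulate (λ x∈ → All.lookup 0<λs (∈-deduplicate⁻ _≟_ λs x∈))))
  (*-monoʳ-≤ 2 (sum-deduplicate≤ λs))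

-- From (2m + 1)² = 4 m (m + 1) + 1 ≤ 8k + 1.
≤D : ∀ m k → m * suc m ≤ 2 * k → suc m ≤ D k
≤D m k le = ≤-trans (≤-reflexive (sym (m*n/n≡m (suc m) 2))) (/-monoˡ-≤ 2 (begin
  suc m * 2                    ≡⟨ double m ⟩
  1 + (2 * m + 1)              ≤⟨ +-monoʳ-≤ 1 (≤-pred (≰⇒> too-big)) ⟩
  1 + ⌊√ 1 + 8 * k ⌋           ∎))
  where
  open ≤-Reasoning
  s = ⌊√ 1 + 8 * k ⌋
  double : ∀ m → suc m * 2 ≡ 1 + (2 * m + 1)
  double = solve-∀
  square : ∀ m → (2 * m + 1) * (2 * m + 1) ≡ 1 + 4 * (m * suc m)
  square = solve-∀
  too-big : ¬ (suc s ≤ 2 * m + 1)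
  too-big ≤m = <⇒≱ (⌊√⌋-upper (1 + 8 * k)) (begin
    suc s * suc s                ≤⟨ *-mono-≤ ≤m ≤m ⟩
    (2 * m + 1) * (2 * m + 1)    ≡⟨ square m ⟩
    1 + 4 * (m * suc m)          ≤⟨ +-monoʳ-≤ 1 (*-monoʳ-≤ 4 le) ⟩
    1 + 4 * (2 * k)              ≡⟨ cong suc (*-assoc 4 2 k) ⟨
    1 + 8 * k                    ∎)

partitionsWith : ℕ → ℕ → List (List ℕ)
partitionsWith k d = concatMap (λ j → elements (partitions j (d ∸ 1))) (range ((d ∸ 1) * d / 2) k)

-- Arranged as in the formula: `[]` accounts for the summand `p`, and block `d` for the coefficient
-- of `p ^ᴿ d`.
partitionsUpTo : ℕ → List (List ℕ)
partitionsUpTo k = [] ∷ concatMap (partitionsWith k) (range 2 (D k))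

∈-partitionsWith⁻ : ∀ {k d λs} → λs ∈ partitionsWith k d → PartitionUpTo k λs × distinctParts λs ≡ d ∸ 1
∈-partitionsWith⁻ {k} {d} λs∈
  with j , j∈ , λs∈j ← find (∈-concatMap⁻ (λ j → elements (partitions j (d ∸ 1))) 
         {xs = range ((d ∸ 1) * d / 2) k} λs∈)
  with (0<λs , λs↗ , refl) , d≡ ← Equivalence.to (member⇔ (partitions j (d ∸ 1))) λs∈j =
    (0<λs , λs↗ , proj₂ (∈-range⁻ ((d ∸ 1) * d / 2) k j∈)) , d≡

∈-partitionsUpTo⁻ : ∀ {k λs} → λs ∈ partitionsUpTo k → PartitionUpTo k λs
∈-partitionsUpTo⁻ (here refl) = [] , [] , z≤n
∈-partitionsUpTo⁻ {k} (there λs∈)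
  with d , _ , λs∈d ← find (∈-concatMap⁻ (partitionsWith k) {xs = range 2 (D k)} λs∈) =
  proj₁ (∈-partitionsWith⁻ {k} {d} λs∈d)

∈-partitionsUpTo⁺ : ∀ {k λs} → PartitionUpTo k λs → λs ∈ partitionsUpTo k
∈-partitionsUpTo⁺ {k} {[]}     _ = here refl
∈-partitionsUpTo⁺ {k} {x ∷ xs} (0<λs , λs↗ , ≤k) = there (∈-concatMap⁺ (partitionsWith k)
  -- The block is number `suc d`: at least 2 since a nonempty list has a part, and at most `D k` by
  -- `≤D`.
  (lose (∈-range⁺ {2} (s≤s (s≤s z≤n)) (≤D d k (≤-trans bound (*-monoʳ-≤ 2 ≤k))))
    (∈-concatMap⁺ (λ j → elements (partitions j d))
      (lose (∈-range⁺ (≤-trans (/-monoˡ-≤ 2 (≤-trans bound (≤-reflexive (*-comm 2 j))))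
                               (≤-reflexive (m*n/n≡m j 2))) ≤k)
        (Equivalence.from (member⇔ (partitions j d)) ((0<λs , λs↗ , refl) , refl))))))
  where
  d = distinctParts (x ∷ xs)
  j = sum (x ∷ xs)
  bound : d * suc d ≤ 2 * j
  bound = distinctParts-bound 0<λs

-- The number of distinct parts tells the blocks apart, and the sum tells apart the pieces within a
-- block. Since `d ≥ 2`, no block contains `[]`.
partitionsUpTo-unique : ∀ k → Unique (partitionsUpTo k)
partitionsUpTo-unique k = All.tabulate nonempty
  ∷ concatMap-unique (suc ∘ distinctParts) {range 2 (D k)}
      (λ {d} d∈ λs∈ → trans (cong suc (proj₂ (∈-partitionsWith⁻ {k} {d} λs∈)))
                            (m+[n∸m]≡n (≤-trans (n≤1+n 1) (proj₁ (∈-range⁻ 2 (D k) d∈)))))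
      (λ d → concatMap-unique sum
               (λ {j} j∈ λs∈ → proj₂ (proj₂ (proj₁ (Equivalence.to (member⇔ (partitions j (d ∸ 1))) λs∈))))
               (λ j → unique (partitions j (d ∸ 1))) (range-unique ((d ∸ 1) * d / 2) k))
      (range-unique 2 (D k))
  where
  nonempty : ∀ {λs} → λs ∈ concatMap (partitionsWith k) (range 2 (D k)) → [] ≢ λs
  nonempty λs∈ refl
    with d , d∈ , λs∈d ← find (∈-concatMap⁻ (partitionsWith k) {xs = range 2 (D k)} λs∈)
    with 0≡ ← proj₂ (∈-partitionsWith⁻ {k} {d} λs∈d) =
      <-irrefl 0≡ (m<n⇒0<n∸m (proj₁ (∈-range⁻ 2 (D k) d∈)))

containedIn? : ∀ {n} (A : Subset n) → Decidable (ContainedIn A)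
containedIn? A S = Fin.all? λ a → (0 <? mult a S) →-dec (a ∈ˢ? A)

-- Counting the zero-sum free sequences inside a given subset.

module Encoded (n k ℓ : ℕ) .{{_ : NonZero n}} (adm : Admissible n k)
               (n≡ : n ≡ suc (k + ℓ)) (k<ℓ : k < ℓ) where

  open Encoding n k ℓ adm n≡ k<ℓ

  codes : List (Fin n × List ℕ)
  codes = cartesianProduct (elements (generators n)) (partitionsUpTo k)

  ∈-codes⁻ : ∀ {g λs} → (g , λs) ∈ codes → IsGenerator n g × PartitionUpTo k λs
  ∈-codes⁻ gλs∈ with g∈ , λs∈ ← ∈-cartesianProduct⁻ (elements (generators n)) (partitionsUpTo k) gλs∈ =
    Equivalence.to (member⇔ (generators n)) g∈ , ∈-partitionsUpTo⁻ λs∈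

  zeroSumFree : List (Sequence n)
  zeroSumFree = map (uncurry encode) codes

  zeroSumFree-unique : Unique zeroSumFree
  zeroSumFree-unique = Unique-map⁺ injective (Unique.cartesianProduct⁺ (unique (generators n)) (partitionsUpTo-unique k))
    where
    injective : ∀ {x y} → x ∈ codes → y ∈ codes → uncurry encode x ≡ uncurry encode y → x ≡ y
    injective x∈ y∈ eq with gen , part ← ∈-codes⁻ x∈ | gen′ , part′ ← ∈-codes⁻ y∈
      with refl , refl ← encode-injective gen gen′ part part′ eq = refl

  -- The list `zeroSumFree` is the same for all `A`; the subset enters through the filter alone, so
  -- that the count becomes a sum of indicators.
  N≡ : ∀ A → N n A ℓ ≡ length (filter (containedIn? A) zeroSumFree)
  N≡ A = ≤-antisym (Unique-⊆⇒length≤ (unique sequences) ⊆₁)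
                   (Unique-⊆⇒length≤ (Unique.filter⁺ (containedIn? A) zeroSumFree-unique) ⊆₂)
    where
    sequences = zeroSumFreeSequences n A ℓ

    ⊆₁ : elements sequences ⊆ filter (containedIn? A) zeroSumFree
    ⊆₁ {S} S∈ with |S| , zsf , S⊆A ← Equivalence.to (member⇔ sequences) S∈
      with g , λs , gen , part , refl ← encode-surjective S |S| zsf =
        ∈-filter⁺ (containedIn? A) (∈-map⁺ (uncurry encode) (∈-cartesianProduct⁺
          (Equivalence.from (member⇔ (generators n)) gen) (∈-partitionsUpTo⁺ part))) S⊆A

    ⊆₂ : filter (containedIn? A) zeroSumFree ⊆ elements sequences
    ⊆₂ {S} S∈ with S∈′ , S⊆A ← ∈-filter⁻ (containedIn? A) {xs = zeroSumFree} S∈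
      with (g , λs) , gλs∈ , refl ← ∈-map⁻ (uncurry encode) S∈′
      with gen , part ← ∈-codes⁻ gλs∈ =
        Equivalence.from (member⇔ sequences) (∣encode∣ part g , encode-ZeroSumFree part gen , S⊆A)

length-concatMap : ∀ {A B : Set} (f : A → List B) xs → length (concatMap f xs) ≡ sum (map (length ∘ f) xs)
length-concatMap f []       = refl
length-concatMap f (x ∷ xs) = trans (length-++ (f x)) (cong (length (f x) +_) (length-concatMap f xs))

-- Containment in a random subset and the expectation.

module _ {n} (S : Sequence n) (A : Subset n) where

  containedIn-zero : ∀ {b} → ContainedIn (b ∷ A) (0 ∷ S) ⇔ ContainedIn A S
  containedIn-zero = mk⇔ (λ S⊆A a 0<m → drop (S⊆A (suc a) 0<m)) λ { S⊆A (suc a) 0<m → there (S⊆A a 0<m) }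
    where
    drop : ∀ {b a} → suc a Subset.∈ b ∷ A → a Subset.∈ A
    drop (there a∈) = a∈

  containedIn-suc : ∀ {s} → ContainedIn (true ∷ A) (suc s ∷ S) ⇔ ContainedIn A S
  containedIn-suc = mk⇔ (λ S⊆A a 0<m → drop (S⊆A (suc a) 0<m))
    λ { S⊆A zero _ → here ; S⊆A (suc a) 0<m → there (S⊆A a 0<m) }
    where
    drop : ∀ {b a} → suc a Subset.∈ b ∷ A → a Subset.∈ A
    drop (there a∈) = a∈

  ¬containedIn : ∀ {s} → ¬ ContainedIn (false ∷ A) (suc s ∷ S)
  ¬containedIn S⊆A with () ← S⊆A zero (s≤s z≤n)

module Expectation {c ℓ₁ ℓ₂} (R : OrderedCommutativeRing c ℓ₁ ℓ₂) where

  private module ℛ = OrderedCommutativeRing R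
  open ℛ using (Carrier; _≈_; _+ᴿ_; _*ᴿ_; _-ᴿ_; -_; 0#; 1#; reflexive; +-cong; +-congˡ; +-congʳ;
                *-congˡ; *-congʳ; zeroˡ; zeroʳ; distribˡ; distribʳ; -‿inverseˡ)
  open RandomSubset R
  open SetoidReasoning ℛ.setoid

  Σᴸ : {A : Set} → List A → (A → Carrier) → Carrier
  Σᴸ xs f = foldr (λ x s → f x +ᴿ s) 0# xs

  module _ {A : Set} where

    Σᴸ-cong : ∀ xs {f g : A → Carrier} → (∀ {x} → x ∈ xs → f x ≈ g x) → Σᴸ xs f ≈ Σᴸ xs g
    Σᴸ-cong []       f≈g = ℛ.refl
    Σᴸ-cong (x ∷ xs) f≈g = +-cong (f≈g (here refl)) (Σᴸ-cong xs (f≈g ∘ there))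

    Σᴸ-++ : ∀ xs ys (f : A → Carrier) → Σᴸ (xs ++ ys) f ≈ Σᴸ xs f +ᴿ Σᴸ ys f
    Σᴸ-++ []       ys f = ℛ.sym (ℛ.+-identityˡ _)
    Σᴸ-++ (x ∷ xs) ys f = ℛ.trans (+-congˡ (Σᴸ-++ xs ys f)) (ℛ.sym (ℛ.+-assoc _ _ _))

    Σᴸ-*ˡ : ∀ a xs (f : A → Carrier) → Σᴸ xs (λ x → a *ᴿ f x) ≈ a *ᴿ Σᴸ xs f
    Σᴸ-*ˡ a []       f = ℛ.sym (zeroʳ a)
    Σᴸ-*ˡ a (x ∷ xs) f = ℛ.trans (+-congˡ (Σᴸ-*ˡ a xs f)) (ℛ.sym (distribˡ a _ _))

    Σᴸ-0 : ∀ (xs : List A) → Σᴸ xs (λ _ → 0#) ≈ 0#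
    Σᴸ-0 []       = ℛ.refl
    Σᴸ-0 (x ∷ xs) = ℛ.trans (ℛ.+-identityˡ _) (Σᴸ-0 xs)

    Σᴸ-const : ∀ (xs : List A) a → Σᴸ xs (λ _ → a) ≈ ⟨ length xs ⟩ *ᴿ a
    Σᴸ-const []       a = ℛ.sym (zeroˡ a)
    Σᴸ-const (x ∷ xs) a = ℛ.trans (+-cong (ℛ.sym (ℛ.*-identityˡ a)) (Σᴸ-const xs a)) (ℛ.sym (distribʳ a _ _))

    Σᴸ-+ : ∀ xs (f g : A → Carrier) → Σᴸ xs (λ x → f x +ᴿ g x) ≈ Σᴸ xs f +ᴿ Σᴸ xs g
    Σᴸ-+ []       f g = ℛ.sym (ℛ.+-identityˡ 0#)
    Σᴸ-+ (x ∷ xs) f g = begin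
      f x +ᴿ g x +ᴿ Σᴸ xs (λ x → f x +ᴿ g x)       ≈⟨ +-congˡ (Σᴸ-+ xs f g) ⟩
      f x +ᴿ g x +ᴿ (Σᴸ xs f +ᴿ Σᴸ xs g)           ≈⟨ interchange (f x) (g x) _ _ ⟩
      f x +ᴿ Σᴸ xs f +ᴿ (g x +ᴿ Σᴸ xs g)           ∎
      where open import Algebra.Properties.CommutativeSemigroup ℛ.+-commutativeSemigroup using (interchange)

    indicator : {P : A → Set} → Decidable P → A → Carrier
    indicator P? x = if does (P? x) then 1# else 0#

    ⟨length-filter⟩ : ∀ {P : A → Set} (P? : Decidable P) xs → ⟨ length (filter P? xs) ⟩ ≈ Σᴸ xs (indicator P?)
    ⟨length-filter⟩ P? []       = ℛ.refl
    ⟨length-filter⟩ P? (x ∷ xs) with does (P? x)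
    ... | true  = +-congˡ (⟨length-filter⟩ P? xs)
    ... | false = ℛ.trans (⟨length-filter⟩ P? xs) (ℛ.sym (ℛ.+-identityˡ _))

  Σᴸ-map : ∀ {A B : Set} (h : A → B) xs f → Σᴸ (map h xs) f ≈ Σᴸ xs (f ∘ h)
  Σᴸ-map h []       f = ℛ.refl
  Σᴸ-map h (x ∷ xs) f = +-congˡ (Σᴸ-map h xs f)

  Σᴸ-concatMap : ∀ {A B : Set} (h : A → List B) xs f → Σᴸ (concatMap h xs) f ≈ Σᴸ xs (λ x → Σᴸ (h x) f)
  Σᴸ-concatMap h []       f = ℛ.refl
  Σᴸ-concatMap h (x ∷ xs) f = ℛ.trans (Σᴸ-++ (h x) _ f) (+-congˡ (Σᴸ-concatMap h xs f))

  Σᴸ-product : ∀ {A B C : Set} (h : A → B → C) xs ys f →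
               Σᴸ (cartesianProductWith h xs ys) f ≈ Σᴸ xs (λ x → Σᴸ ys (λ y → f (h x y)))
  Σᴸ-product h []       ys f = ℛ.refl
  Σᴸ-product h (x ∷ xs) ys f =
    ℛ.trans (Σᴸ-++ (map (h x) ys) _ f) (+-cong (Σᴸ-map (h x) ys f) (Σᴸ-product h xs ys f))

  Σᴸ-swap : ∀ {A B : Set} xs ys (f : A → B → Carrier) →
            Σᴸ xs (λ x → Σᴸ ys (f x)) ≈ Σᴸ ys (λ y → Σᴸ xs (λ x → f x y))
  Σᴸ-swap []       ys f = ℛ.sym (Σᴸ-0 ys)
  Σᴸ-swap (x ∷ xs) ys f = ℛ.trans (+-congˡ (Σᴸ-swap xs ys f)) (ℛ.sym (Σᴸ-+ ys (f x) _))

  module _ (p : Carrier) where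

    p+[1-p]≈1 : p +ᴿ (1# -ᴿ p) ≈ 1#
    p+[1-p]≈1 = begin
      p +ᴿ (1# +ᴿ - p)     ≈⟨ ℛ.+-comm p _ ⟩
      1# +ᴿ - p +ᴿ p       ≈⟨ ℛ.+-assoc 1# (- p) p ⟩
      1# +ᴿ (- p +ᴿ p)     ≈⟨ +-congˡ (-‿inverseˡ p) ⟩
      1# +ᴿ 0#             ≈⟨ ℛ.+-identityʳ 1# ⟩
      1#                   ∎

    -- Summed over all `A`, this is the probability that the random subset contains the support of
    -- `S`.
    weight : ∀ {n} → Sequence n → Subset n → Carrier
    weight S A = ℙ p A *ᴿ (if does (containedIn? A S) then 1# else 0#)

    weight-true : ∀ {n} s (S : Sequence n) A → weight (s ∷ S) (true ∷ A) ≈ p *ᴿ weight S A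
    weight-true s S A = ℛ.trans (*-congˡ (reflexive (cong (if_then 1# else 0#) (lemma s)))) (ℛ.*-assoc p _ _)
      where
      lemma : ∀ s → does (containedIn? (true ∷ A) (s ∷ S)) ≡ does (containedIn? A S)
      lemma zero    = does-⇔ (containedIn-zero S A) (containedIn? (true ∷ A) (0 ∷ S)) (containedIn? A S)
      lemma (suc s) = does-⇔ (containedIn-suc S A) (containedIn? (true ∷ A) (suc s ∷ S)) (containedIn? A S)

    weight-false-zero : ∀ {n} (S : Sequence n) A → weight (0 ∷ S) (false ∷ A) ≈ (1# -ᴿ p) *ᴿ weight S A
    weight-false-zero S A = ℛ.trans
      (*-congˡ (reflexive (cong (if_then 1# else 0#)
        (does-⇔ (containedIn-zero S A) (containedIn? (false ∷ A) (0 ∷ S)) (containedIn? A S)))))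
      (ℛ.*-assoc (1# -ᴿ p) _ _)

    weight-false-suc : ∀ {n} s (S : Sequence n) A → weight (suc s ∷ S) (false ∷ A) ≈ 0#
    weight-false-suc s S A = ℛ.trans
      (*-congˡ (reflexive (cong (if_then 1# else 0#)
        (dec-false (containedIn? (false ∷ A) (suc s ∷ S)) (¬containedIn S A)))))
      (zeroʳ _)

    -- Independence, one group element at a time: an element of the support contributes the factor
    -- `p`, any other element the factor `p + (1 - p) = 1`.
    ℙ-contains : ∀ {n} (S : Sequence n) →
                 Σᴸ (elements (vecs bools n)) (weight S) ≈ p ^ᴿ length (support S)
    ℙ-contains [] = ℛ.trans (ℛ.+-identityʳ _) (ℛ.*-identityʳ 1#)
    ℙ-contains {suc n} (s ∷ S) = ℛ.trans (Σᴸ-product _∷_ (true ∷ false ∷ []) subsets (weight (s ∷ S)))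
      (ℛ.trans (+-congˡ (ℛ.+-identityʳ _)) (ℛ.trans (+-congʳ true-part) (rest s)))
      where
      subsets = elements (vecs bools n)
      X = Σᴸ subsets (weight S)

      true-part : Σᴸ subsets (λ A → weight (s ∷ S) (true ∷ A)) ≈ p *ᴿ X
      true-part = ℛ.trans (Σᴸ-cong subsets (λ {A} _ → weight-true s S A)) (Σᴸ-*ˡ p subsets (weight S))

      power : length (map suc (support S)) ≡ length (support S)
      power = length-map suc (support S)

      rest : ∀ s → p *ᴿ X +ᴿ Σᴸ subsets (λ A → weight (s ∷ S) (false ∷ A)) ≈ p ^ᴿ length (support (s ∷ S))
      rest zero = begin
        p *ᴿ X +ᴿ Σᴸ subsets (λ A → weight (0 ∷ S) (false ∷ A))
          ≈⟨ +-congˡ (ℛ.trans (Σᴸ-cong subsets (λ {A} _ → weight-false-zero S A)) (Σᴸ-*ˡ _ subsets (weight S))) ⟩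
        p *ᴿ X +ᴿ (1# -ᴿ p) *ᴿ X     ≈⟨ distribʳ X p _ ⟨
        (p +ᴿ (1# -ᴿ p)) *ᴿ X        ≈⟨ *-congʳ p+[1-p]≈1 ⟩
        1# *ᴿ X                      ≈⟨ ℛ.*-identityˡ X ⟩
        X                            ≈⟨ ℙ-contains S ⟩
        p ^ᴿ length (support S)      ≡⟨ cong (p ^ᴿ_) power ⟨
        p ^ᴿ length (map suc (support S)) ∎
      rest (suc s) = begin
        p *ᴿ X +ᴿ Σᴸ subsets (λ A → weight (suc s ∷ S) (false ∷ A))
          ≈⟨ +-congˡ (ℛ.trans (Σᴸ-cong subsets (λ {A} _ → weight-false-suc s S A)) (Σᴸ-0 subsets)) ⟩
        p *ᴿ X +ᴿ 0#                      ≈⟨ ℛ.+-identityʳ _ ⟩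
        p *ᴿ X                            ≈⟨ *-congˡ (ℙ-contains S) ⟩
        p *ᴿ p ^ᴿ length (support S)      ≡⟨ cong (λ m → p ^ᴿ suc m) power ⟨
        p ^ᴿ suc (length (map suc (support S))) ∎

    module _ (n k ℓ : ℕ) .{{_ : NonZero n}} (adm : Admissible n k)
             (n≡ : n ≡ suc (k + ℓ)) (k<ℓ : k < ℓ) where

      open Encoding n k ℓ adm n≡ k<ℓ
      open Encoded n k ℓ adm n≡ k<ℓ

      𝔼-N : 𝔼 p (λ A → ⟨ N n A ℓ ⟩) ≈ Σᴸ zeroSumFree (λ S → p ^ᴿ length (support S))
      𝔼-N = begin
        Σᴸ subsets (λ A → ℙ p A *ᴿ ⟨ N n A ℓ ⟩)
          ≈⟨ Σᴸ-cong subsets (λ {A} _ → ℛ.trans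
               (*-congˡ (ℛ.trans (reflexive (cong ⟨_⟩ (N≡ A))) (⟨length-filter⟩ (containedIn? A) zeroSumFree)))
               (ℛ.sym (Σᴸ-*ˡ (ℙ p A) zeroSumFree _))) ⟩
        Σᴸ subsets (λ A → Σᴸ zeroSumFree (λ S → weight S A))
          ≈⟨ Σᴸ-swap subsets zeroSumFree (λ A S → weight S A) ⟩
        Σᴸ zeroSumFree (λ S → Σᴸ subsets (weight S))
          ≈⟨ Σᴸ-cong zeroSumFree (λ {S} _ → ℙ-contains S) ⟩
        Σᴸ zeroSumFree (λ S → p ^ᴿ length (support S)) ∎
        where subsets = elements (vecs bools n)

      -- The size of the support depends on the partition only, so summing over the generators just
      -- contributes the factor `φ n`.
      Σ-codes : Σᴸ zeroSumFree (λ S → p ^ᴿ length (support S)) ≈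
                ⟨ φ n ⟩ *ᴿ Σᴸ (partitionsUpTo k) (λ λs → p ^ᴿ suc (distinctParts λs))
      Σ-codes = begin
        Σᴸ zeroSumFree (λ S → p ^ᴿ length (support S))
          ≈⟨ Σᴸ-map (uncurry encode) codes _ ⟩
        Σᴸ codes (λ c → p ^ᴿ length (support (uncurry encode c)))
          ≈⟨ Σᴸ-cong codes (λ { {g , λs} c∈ → let gen , part = ∈-codes⁻ c∈ in
               reflexive (cong (p ^ᴿ_) (length-support-encode part gen)) }) ⟩
        Σᴸ codes (λ c → p ^ᴿ suc (distinctParts (proj₂ c)))
          ≈⟨ Σᴸ-product _,_ (elements (generators n)) (partitionsUpTo k) _ ⟩
        Σᴸ (elements (generators n)) (λ _ → Σᴸ (partitionsUpTo k) (λ λs → p ^ᴿ suc (distinctParts λs)))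
          ≈⟨ Σᴸ-const (elements (generators n)) _ ⟩
        ⟨ φ n ⟩ *ᴿ Σᴸ (partitionsUpTo k) (λ λs → p ^ᴿ suc (distinctParts λs)) ∎

    Σ-partitions : ∀ k → Σᴸ (partitionsUpTo k) (λ λs → p ^ᴿ suc (distinctParts λs)) ≈
                   p +ᴿ ∑ᴿ 2 (D k) (λ d → p ^ᴿ d *ᴿ ⟨ ∑ ((d ∸ 1) * d / 2) k (λ j → q j (d ∸ 1)) ⟩)
    -- The empty partition contributes `p ^ᴿ 1`; within block `d` the summand is constantly
    -- `p ^ᴿ d`.
    Σ-partitions k = +-cong (ℛ.*-identityʳ p) (ℛ.trans
      (Σᴸ-concatMap (partitionsWith k) (range 2 (D k)) _)
      (Σᴸ-cong (range 2 (D k)) (λ {d} d∈ → begin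
        Σᴸ (partitionsWith k d) (λ λs → p ^ᴿ suc (distinctParts λs))
          ≈⟨ Σᴸ-cong (partitionsWith k d) (λ λs∈ → reflexive (cong (p ^ᴿ_)
               (trans (cong suc (proj₂ (∈-partitionsWith⁻ {k} {d} λs∈)))
                        (m+[n∸m]≡n (≤-trans (n≤1+n 1) (proj₁ (∈-range⁻ 2 (D k) d∈))))))) ⟩
        Σᴸ (partitionsWith k d) (λ _ → p ^ᴿ d)
          ≈⟨ Σᴸ-const (partitionsWith k d) _ ⟩
        ⟨ length (partitionsWith k d) ⟩ *ᴿ p ^ᴿ d
          ≈⟨ ℛ.*-comm _ _ ⟩
        p ^ᴿ d *ᴿ ⟨ length (partitionsWith k d) ⟩
          ≡⟨ cong (λ m → p ^ᴿ d *ᴿ ⟨ m ⟩)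
               (length-concatMap (λ j → elements (partitions j (d ∸ 1))) (range ((d ∸ 1) * d / 2) k)) ⟩
        p ^ᴿ d *ᴿ ⟨ ∑ ((d ∸ 1) * d / 2) k (λ j → q j (d ∸ 1)) ⟩ ∎)))

theorem2 : ∀ {c ℓ₁ ℓ₂} (R : OrderedCommutativeRing c ℓ₁ ℓ₂) →
    let open OrderedCommutativeRing R
        open RandomSubset R
    in
    (n k : ℕ) .{{_ : NonZero n}} → 2 ≤ n → k ≤ n / 3 →
    ¬ (n ≡ 3 × k ≡ 1) → ¬ (n ≡ 6 × k ≡ 2) →
    (p : Carrier) → 0# ≤ᴿ p → p ≤ᴿ 1# →
    𝔼 p (λ A → ⟨ N n A (n ∸ 1 ∸ k) ⟩)
      ≈ ⟨ φ n ⟩ *ᴿ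
          (p +ᴿ ∑ᴿ 2 (D k) λ d →
            (p ^ᴿ d) *ᴿ ⟨ ∑ ((d ∸ 1) * d / 2) k (λ j → q j (d ∸ 1)) ⟩)
theorem2 R n k n≥2 k≤n/3 ≢3,1 ≢6,2 p _ _ =
  ℛ.trans (𝔼-N p n k ℓ adm n≡ k<ℓ) (ℛ.trans (Σ-codes p n k ℓ adm n≡ k<ℓ) (ℛ.*-congˡ (Σ-partitions p k)))
  where
  module ℛ = OrderedCommutativeRing R
  open Expectation R

  ℓ = n ∸ 1 ∸ k

  adm : Admissible n k
  adm = admissible n≥2 (≤-trans (≤-reflexive (*-comm 3 k)) (≤-trans (*-monoˡ-≤ 3 k≤n/3) (m/n*n≤m n 3))) ≢3,1 ≢6,2

  n≡ : n ≡ suc (k + ℓ)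
  n≡ = trans (sym (m+[n∸m]≡n (≤-trans (s≤s (≤-trans (m≤m+n k _) (n≤1+n _))) (2+2k≤n adm))))
               (cong (suc k +_) (sym (∸-+-assoc n 1 k)))

  k<ℓ : k < ℓ
  -- Cancel `suc k` in `2 + 2 * k ≤ n ≡ suc k + ℓ`.
  k<ℓ = +-cancelˡ-≤ (suc k) _ _ (≤-trans (≤-reflexive
    (trans (+-suc (suc k) k) (cong (λ m → 2 + (k + m)) (sym (+-identityʳ k)))))
    (≤-trans (2+2k≤n adm) (≤-reflexive n≡)))
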